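{- For every $n>0$, the $H$-triangle $H_n(x,y)$ associated with the Hochschild lattice $\mathrm{Hoch}(n)$ satisfies $$H_n(x,y)=\sum_{u\in\mathrm{Tri}(n)}x^{|\mathrm{Can}(u)|}y^{\mathrm{neg}(u)}.$$
   Context: Hochschild lattice. For $n\geq 1$, a triword of length $n$ is a tuple $u=(u_1,\ldots,u_n)$ such that (T1) $u_i\in\{0,1,2\}$ for all $i$; (T2) $u_1\neq 2$; (T3) if $u_i=0$, then $u_j\neq 1$ for all $j>i$. Let $\mathrm{Tri}(n)$ be the set of all triwords of length $n$. The Hochschild lattice is $\mathrm{Hoch}(n)=(\mathrm{Tri}(n),\leq)$ where $\leq$ is the componentwise order. It is known to be a semidistributive lattice: the join is the componentwise maximum, and the meet is obtained by taking the componentwise minimum and then replacing by $0$ every entry $1$ that has an entry $0$ somewhere to its left. Labels, canonical join representations, core label order. Let $L$ be a finite semidistributive lattice. For a cover relation $a\lessdot b$ put $\lambda(a,b)=\min\{c\in L\mid a\vee c=b\}$; this minimum exists and is join irreducible. The canonical join representation of $a\in L$ is $\mathrm{Can}(a)=\{\lambda(b,a)\mid b\lessdot a\}$ (equivalently, the antichain with join $a$ that refines every subset with join $a$). The nucleus of $a$ is $a_\downarrow=a\wedge\bigwedge_{b\lessdot a}b$. The core label set of $a$ is $\Psi(a)=\{\lambda(b,b')\mid a_\downarrow\leq b\lessdot b'\leq a\}$. The map $a\mapsto\Psi(a)$ is injective. The core label order $\mathrm{CLO}(L)$ is the poset $(L,\sqsubseteq)$ where $a\sqsubseteq b$ if and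 only if $\Psi(a)\subseteq\Psi(b)$. $H$-triangle. The poset $\mathrm{CLO}(\mathrm{Hoch}(n))$ is graded with least element $(0,\ldots,0)$; let $\mathrm{rk}$ be its rank function (so $\mathrm{rk}(0,\ldots,0)=0$) and $\mu_n$ its Möbius function (with $\mu_n(u,v)=0$ if $u\not\sqsubseteq v$). Define $$M_n(x,y)=\sum_{u,v\in\mathrm{Tri}(n)}\mu_n(u,v)\,x^{\mathrm{rk}(u)}y^{\mathrm{rk}(v)},\qquad H_n(x,y)=\bigl(x(y-1)+1\bigr)^n M_n\left(\frac{y}{y-1},\frac{x(y-1)}{x(y-1)+1}\right).$$ Atoms. Let $\mathrm{Atom}(n)$ be the set of atoms of $\mathrm{Hoch}(n)$, i.e. of elements covering $(0,\ldots,0)$. Explicitly, these are $(1,0,\ldots,0)$ and, for $2\leq i\leq n$, the tuple with a $2$ in position $i$ and zeros elsewhere. For $u\in\mathrm{Tri}(n)$ let $\mathrm{neg}(u)=|\mathrm{Can}(u)\cap\mathrm{Atom}(n)|$, where $\mathrm{Can}(u)$ is taken in $\mathrm{Hoch}(n)$. -}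

module Defs where

open import Algebra.Bundles using (CommutativeRing)
import Algebra.Construct.NaturalChoice.Max as Max
import Algebra.Construct.NaturalChoice.Min as Min
open import Data.Empty using (⊥-elim)
open import Data.Fin.Base using (Fin; toℕ)
import Data.Fin.Base as Fin
import Data.Fin.Properties as Fin
open import Data.Fin.Patterns using (0F; 1F; 2F)
import Data.Integer.Base as ℤ
open ℤ using (ℤ; +_; -[1+_]; 0ℤ; 1ℤ)
import Data.Irrelevant as Irrelevant
open Irrelevant using ([_])
open import Data.List.Base
  using (List; []; _∷_; map; foldr; filter; length; allFin; cartesianProductWith; mapMaybe)
open import Data.List.Membership.Propositional using (_∈_; lose)
open import Data.List.Membership.Propositional.Properties
  using (∈-allFin; ∈-cartesianProductWith⁺)
open import Data.List.Relation.Unary.All as All using (All; []; _∷_)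
open import Data.List.Relation.Unary.AllPairs using ([]; _∷_)
open import Data.List.Relation.Unary.Any as Any using (here; there)
open import Data.List.Relation.Unary.Unique.Propositional using (Unique)
import Data.List.Relation.Unary.Unique.Propositional.Properties as Unique
open import Data.Maybe.Base using (Maybe; just; nothing)
open import Data.Nat.Base as Nat using (ℕ; zero; suc; z≤n)
import Data.Nat.Properties as ℕ
open import Data.Product.Base using (∃; _×_; _,_; proj₁; proj₂)
open import Data.Refinement.Base using (Refinement-syntax; value; _,_)
import Data.Refinement.Properties as Refinement
open import Data.Sum.Base using (_⊎_; inj₁; inj₂)
open import Data.Vec.Base using (Vec; []; _∷_; lookup; tabulate; zipWith; replicate)
import Data.Vec.Properties as Vec
open import Data.Vec.Relation.Binary.Pointwise.Extensional using (ext; extensional⇒inductive)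
open import Data.Vec.Relation.Binary.Pointwise.Inductive as Pointwise using (Pointwise)
open import Function.Base using (_∋_)
open import Level using (0ℓ)
open import Relation.Binary.Core using (Rel)
open import Relation.Binary.Definitions using (Decidable; DecidableEquality; Minimum)
open import Relation.Binary.Lattice using (IsLattice; Supremum; Infimum)
open import Relation.Binary.PropositionalEquality
  using (_≡_; _≢_; refl; sym; trans; cong; cong₂; subst; isEquivalence)
open import Relation.Binary.Structures using (IsPartialOrder)
import Relation.Binary.Construct.NonStrictToStrict as Strict
open import Relation.Nullary using (Dec; yes; no; ¬_; ¬?)
open import Relation.Nullary.Decidable using (map′; _×-dec_; _→-dec_; recompute)
open import Relation.Unary using (Pred; _⊆_)
import Relation.Unary as Unary

module _ {A : Set} (_≤_ : Rel A 0ℓ) where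

  Covers : Rel A 0ℓ
  Covers a b = a < b × (∀ c → ¬ (a < c × c < b))
    where open Strict _≡_ _≤_ using (_<_)

  IsRankFunction : A → (A → ℕ) → Set
  IsRankFunction ⊥ rk = rk ⊥ ≡ 0 × (∀ a b → Covers a b → rk b ≡ suc (rk a))

record FiniteLattice : Set₁ where
  infix  4 _≤_ _≤?_ _≟_
  infixr 6 _∨_
  infixr 7 _∧_
  field
    Carrier   : Set
    _≤_       : Rel Carrier 0ℓ
    _∨_ _∧_   : Carrier → Carrier → Carrier
    isLattice : IsLattice _≡_ _≤_ _∨_ _∧_
    ⊥         : Carrier
    minimum   : Minimum _≤_ ⊥
    _≟_       : DecidableEquality Carrier
    _≤?_      : Decidable _≤_
    elements  : List Carrier
    complete  : ∀ a → a ∈ elements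
    unique    : Unique elements

  open IsLattice isLattice public

  all? : ∀ {P : Pred Carrier 0ℓ} → Unary.Decidable P → Dec (∀ a → P a)
  all? P? = map′ (λ ps a → All.lookup ps (complete a)) (λ p → All.tabulate λ {a} _ → p a)
                 (All.all? P? elements)

  any? : ∀ {P : Pred Carrier 0ℓ} → Unary.Decidable P → Dec (∃ P)
  any? P? = map′ Any.satisfied (λ (a , p) → lose (complete a) p) (Any.any? P? elements)

  ∣_∣ : {P : Pred Carrier 0ℓ} → Unary.Decidable P → ℕ
  ∣ P? ∣ = length (filter P? elements)

  covers? : ∀ {_≼_ : Rel Carrier 0ℓ} → Decidable _≼_ → Decidable (Covers _≼_)
  covers? {_≼_} _≼?_ a b = (a <? b) ×-dec all? λ c → ¬? ((a <? c) ×-dec (c <? b))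
    where
    open Strict _≡_ _≼_ using (_<_)
    _<?_ : Decidable _<_
    a <? b = (a ≼? b) ×-dec ¬? (a ≟ b)

  -- The three clauses determine μ: the middle one is Σ_{a ≼ c ≼ b} μ(a,c) = 0 for a ≺ b.
  IsMöbiusFunction : {_≼_ : Rel Carrier 0ℓ} → Decidable _≼_ → (Carrier → Carrier → ℤ) → Set
  IsMöbiusFunction {_≼_} _≼?_ μ =
      (∀ a → μ a a ≡ 1ℤ)
    × (∀ a b → a ≼ b → a ≢ b →
         foldr ℤ._+_ 0ℤ (map (μ a) (filter (λ c → (a ≼? c) ×-dec (c ≼? b)) elements)) ≡ 0ℤ)
    × (∀ a b → ¬ (a ≼ b) → μ a b ≡ 0ℤ)

  infix 4 _⋖_ _⋖?_ _⊑_ _⊑?_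

  _⋖_ : Rel Carrier 0ℓ
  _⋖_ = Covers _≤_

  _⋖?_ : Decidable _⋖_
  _⋖?_ = covers? _≤?_

  Atom : Pred Carrier 0ℓ
  Atom a = ⊥ ⋖ a

  atom? : Unary.Decidable Atom
  atom? a = ⊥ ⋖? a

  -- c = λ(a,b); the minimum need not exist in a lattice that is not semidistributive,
  -- so λ is given by its graph.
  IsLabel : Carrier → Carrier → Pred Carrier 0ℓ
  IsLabel a b c = a ∨ c ≡ b × (∀ d → a ∨ d ≡ b → c ≤ d)

  isLabel? : ∀ a b → Unary.Decidable (IsLabel a b)
  isLabel? a b c = (a ∨ c ≟ b) ×-dec all? λ d → (a ∨ d ≟ b) →-dec (c ≤? d)

  Can : Carrier → Pred Carrier 0ℓ
  Can a c = ∃ λ b → b ⋖ a × IsLabel b a c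

  can? : ∀ a → Unary.Decidable (Can a)
  can? a c = any? λ b → (b ⋖? a) ×-dec isLabel? b a c

  nucleus : Carrier → Carrier
  nucleus a = foldr _∧_ a (filter (_⋖? a) elements)

  Ψ : Carrier → Pred Carrier 0ℓ
  Ψ a c = ∃ λ b → ∃ λ b′ → nucleus a ≤ b × b ⋖ b′ × b′ ≤ a × IsLabel b b′ c

  Ψ? : ∀ a → Unary.Decidable (Ψ a)
  Ψ? a c = any? λ b → any? λ b′ →
    (nucleus a ≤? b) ×-dec (b ⋖? b′) ×-dec (b′ ≤? a) ×-dec isLabel? b b′ c

  _⊑_ : Rel Carrier 0ℓ
  a ⊑ b = Ψ a ⊆ Ψ b

  _⊑?_ : Decidable _⊑_
  a ⊑? b = map′ (λ f {c} → f c) (λ f c → f {c}) (all? λ c → Ψ? a c →-dec Ψ? b c)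

  ∣Can∣ : Carrier → ℕ
  ∣Can∣ a = ∣ can? a ∣

  neg : Carrier → ℕ
  neg a = ∣ (λ c → can? a c ×-dec atom? c) ∣

private
  variable
    n : ℕ

IsTriword : Pred (Vec (Fin 3) n) 0ℓ
IsTriword u =
    (∀ i → toℕ i ≡ 0 → lookup u i ≢ 2F)
  × (∀ i → lookup u i ≡ 0F → ∀ j → i Fin.< j → lookup u j ≢ 1F)

isTriword? : Unary.Decidable (IsTriword {n})
isTriword? u =
        (Fin.all? λ i → (toℕ i ℕ.≟ 0) →-dec ¬? (lookup u i Fin.≟ 2F))
  ×-dec (Fin.all? λ i → (lookup u i Fin.≟ 0F) →-dec
           Fin.all? λ j → (i Fin.<? j) →-dec ¬? (lookup u j Fin.≟ 1F))

-- The proof component is irrelevant, so triwords are equal as soon as their entries are.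
Tri : ℕ → Set
Tri n = [ u ∈ Vec (Fin 3) n ∣ IsTriword u ]

isTriword : (u : Tri n) → IsTriword (value u)
isTriword (u , [ p ]) = recompute (isTriword? u) p

words : ∀ n → List (Vec (Fin 3) n)
words zero    = [] ∷ []
words (suc n) = cartesianProductWith _∷_ (allFin 3) (words n)

toTri : Vec (Fin 3) n → Maybe (Tri n)
toTri u with isTriword? u
... | yes p = just (u , [ p ])
... | no  _ = nothing

triwords : ∀ n → List (Tri n)
triwords n = mapMaybe toTri (words n)

words-complete : (u : Vec (Fin 3) n) → u ∈ words n
words-complete []      = here refl
words-complete (a ∷ u) = ∈-cartesianProductWith⁺ _∷_ (∈-allFin a) (words-complete u)

words-unique : ∀ n → Unique (words n)
words-unique zero    = [] ∷ []
words-unique (suc n) =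
  Unique.cartesianProductWith⁺ _∷_ Vec.∷-injective (Unique.allFin⁺ 3) (words-unique n)

∈-mapMaybe-toTri⁺ : (t : Tri n) {us : List (Vec (Fin 3) n)} →
                    value t ∈ us → t ∈ mapMaybe toTri us
∈-mapMaybe-toTri⁺ t {u ∷ us} t∈ with isTriword? u | t∈
... | yes _ | here refl = here refl
... | yes _ | there t∈′ = there (∈-mapMaybe-toTri⁺ t t∈′)
... | no ¬p | here refl = ⊥-elim (¬p (isTriword t))
... | no  _ | there t∈′ = ∈-mapMaybe-toTri⁺ t t∈′

≢-mapMaybe-toTri : (t : Tri n) {us : List (Vec (Fin 3) n)} →
                   All (value t ≢_) us → All (t ≢_) (mapMaybe toTri us)
≢-mapMaybe-toTri t {[]}     []       = []
≢-mapMaybe-toTri t {u ∷ us} (≢ ∷ ≢s) with isTriword? u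
... | yes _ = (λ eq → ≢ (cong value eq)) ∷ ≢-mapMaybe-toTri t ≢s
... | no  _ = ≢-mapMaybe-toTri t ≢s

mapMaybe-toTri-unique : {us : List (Vec (Fin 3) n)} → Unique us → Unique (mapMaybe toTri us)
mapMaybe-toTri-unique {us = []}     []       = []
mapMaybe-toTri-unique {us = u ∷ us} (≢s ∷ !) with isTriword? u
... | yes p = ≢-mapMaybe-toTri (u , [ p ]) ≢s ∷ mapMaybe-toTri-unique !
... | no  _ = mapMaybe-toTri-unique !

open Max (Fin.≤-totalOrder 3) using (_⊔_; ⊔-sel; x≤x⊔y; x≤y⊔x; ⊔-lub)
open Min (Fin.≤-totalOrder 3) using (_⊓_; ⊓-sel; x⊓y≤x; x⊓y≤y; ⊓-glb)

_≤ʰ_ : Rel (Tri n) 0ℓ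
u ≤ʰ v = Pointwise Fin._≤_ (value u) (value v)

OneAfterZero : Vec (Fin 3) n → Pred (Fin n) 0ℓ
OneAfterZero u i = lookup u i ≡ 1F × ∃ λ j → j Fin.< i × lookup u j ≡ 0F

oneAfterZero? : (u : Vec (Fin 3) n) → Unary.Decidable (OneAfterZero u)
oneAfterZero? u i = (lookup u i Fin.≟ 1F) ×-dec
                    (Fin.any? λ j → (j Fin.<? i) ×-dec (lookup u j Fin.≟ 0F))

clearedEntry : Vec (Fin 3) n → Fin n → Fin 3
clearedEntry u i with oneAfterZero? u i
... | yes _ = 0F
... | no  _ = lookup u i

-- Only the entries equal to 1 with some 0 to their left change, and they become 0.
clear : Vec (Fin 3) n → Vec (Fin 3) n
clear u = tabulate (clearedEntry u)

≤0⇒≡0 : {a : Fin 3} → a Fin.≤ (Fin 3 ∋ 0F) → a ≡ 0F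
≤0⇒≡0 {0F} _ = refl

≤1∧≢1⇒≤0 : {a : Fin 3} → a Fin.≤ (Fin 3 ∋ 1F) → a ≢ 1F → a Fin.≤ (Fin 3 ∋ 0F)
≤1∧≢1⇒≤0 {0F} _ _ = z≤n
≤1∧≢1⇒≤0 {1F} _ ≢ = ⊥-elim (≢ refl)
≤1∧≢1⇒≤0 {2F} (Nat.s≤s ()) _

pointwise : {u v : Vec (Fin 3) n} → (∀ i → lookup u i Fin.≤ lookup v i) → Pointwise Fin._≤_ u v
pointwise f = extensional⇒inductive (ext f)

zipWith-sel : (_∙_ : Fin 3 → Fin 3 → Fin 3) → (∀ a b → (a ∙ b ≡ a) ⊎ (a ∙ b ≡ b)) →
              (u v : Vec (Fin 3) n) → ∀ i {a} → lookup (zipWith _∙_ u v) i ≡ a →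
              (lookup u i ≡ a) ⊎ (lookup v i ≡ a)
zipWith-sel _∙_ sel u v i eq with sel (lookup u i) (lookup v i)
... | inj₁ s = inj₁ (trans (sym s) (trans (sym (Vec.lookup-zipWith _∙_ i u v)) eq))
... | inj₂ s = inj₂ (trans (sym s) (trans (sym (Vec.lookup-zipWith _∙_ i u v)) eq))

u≤u⊔v : (u v : Vec (Fin 3) n) → ∀ i → lookup u i Fin.≤ lookup (zipWith _⊔_ u v) i
u≤u⊔v u v i rewrite Vec.lookup-zipWith _⊔_ i u v = x≤x⊔y (lookup u i) (lookup v i)

v≤u⊔v : (u v : Vec (Fin 3) n) → ∀ i → lookup v i Fin.≤ lookup (zipWith _⊔_ u v) i
v≤u⊔v u v i rewrite Vec.lookup-zipWith _⊔_ i u v = x≤y⊔x (lookup u i) (lookup v i)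

u⊓v≤u : (u v : Vec (Fin 3) n) → ∀ i → lookup (zipWith _⊓_ u v) i Fin.≤ lookup u i
u⊓v≤u u v i rewrite Vec.lookup-zipWith _⊓_ i u v = x⊓y≤x (lookup u i) (lookup v i)

u⊓v≤v : (u v : Vec (Fin 3) n) → ∀ i → lookup (zipWith _⊓_ u v) i Fin.≤ lookup v i
u⊓v≤v u v i rewrite Vec.lookup-zipWith _⊓_ i u v = x⊓y≤y (lookup u i) (lookup v i)

clear≤ : (u : Vec (Fin 3) n) → ∀ i → lookup (clear u) i Fin.≤ lookup u i
clear≤ u i rewrite Vec.lookup∘tabulate (clearedEntry u) i with oneAfterZero? u i
... | yes _ = z≤n
... | no  _ = Fin.≤-refl

clear-greatest : (u : Vec (Fin 3) n) (t : Tri n) → (∀ i → lookup (value t) i Fin.≤ lookup u i) →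
                 ∀ i → lookup (value t) i Fin.≤ lookup (clear u) i
clear-greatest u t t≤u i rewrite Vec.lookup∘tabulate (clearedEntry u) i with oneAfterZero? u i
... | no  _ = t≤u i
... | yes (uᵢ≡1 , j , j<i , uⱼ≡0) =
  ≤1∧≢1⇒≤0 (subst (lookup (value t) i Fin.≤_) uᵢ≡1 (t≤u i))
    (proj₂ (isTriword t) j (≤0⇒≡0 (subst (lookup (value t) j Fin.≤_) uⱼ≡0 (t≤u j))) i j<i)

join-isTriword : {u v : Vec (Fin 3) n} → IsTriword u → IsTriword v → IsTriword (zipWith _⊔_ u v)
join-isTriword {u = u} {v} (u₂ , u₃) (v₂ , v₃) = t₂ , t₃
  where
  t₂ : ∀ i → toℕ i ≡ 0 → lookup (zipWith _⊔_ u v) i ≢ 2F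
  t₂ i i≡0 eq with zipWith-sel _⊔_ ⊔-sel u v i eq
  ... | inj₁ e = u₂ i i≡0 e
  ... | inj₂ e = v₂ i i≡0 e
  t₃ : ∀ i → lookup (zipWith _⊔_ u v) i ≡ 0F → ∀ j → i Fin.< j → lookup (zipWith _⊔_ u v) j ≢ 1F
  t₃ i i≡0 j i<j eq with zipWith-sel _⊔_ ⊔-sel u v j eq
  ... | inj₁ e = u₃ i (≤0⇒≡0 (subst (lookup u i Fin.≤_) i≡0 (u≤u⊔v u v i))) j i<j e
  ... | inj₂ e = v₃ i (≤0⇒≡0 (subst (lookup v i Fin.≤_) i≡0 (v≤u⊔v u v i))) j i<j e

meet-isTriword : {u v : Vec (Fin 3) n} → IsTriword u → IsTriword v →
                 IsTriword (clear (zipWith _⊓_ u v))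
meet-isTriword {u = u} {v} (u₂ , _) (v₂ , _) = t₂ , t₃
  where
  w = zipWith _⊓_ u v
  t₂ : ∀ i → toℕ i ≡ 0 → lookup (clear w) i ≢ 2F
  t₂ i i≡0 eq rewrite Vec.lookup∘tabulate (clearedEntry w) i with oneAfterZero? w i
  t₂ i i≡0 () | yes _
  ... | no _ with zipWith-sel _⊓_ ⊓-sel u v i eq
  ...   | inj₁ e = u₂ i i≡0 e
  ...   | inj₂ e = v₂ i i≡0 e
  t₃ : ∀ i → lookup (clear w) i ≡ 0F → ∀ j → i Fin.< j → lookup (clear w) j ≢ 1F
  t₃ i i≡0 j i<j eq
    rewrite Vec.lookup∘tabulate (clearedEntry w) i | Vec.lookup∘tabulate (clearedEntry w) j
    with oneAfterZero? w j
  t₃ i i≡0 j i<j () | yes _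
  ... | no ¬p with oneAfterZero? w i
  ...   | no  _ = ¬p (eq , i , i<j , i≡0)
  ...   | yes (_ , k , k<i , wₖ≡0) = ¬p (eq , k , ℕ.<-trans k<i i<j , wₖ≡0)

_∨ʰ_ : Tri n → Tri n → Tri n
(u , p) ∨ʰ (v , q) = zipWith _⊔_ u v , Irrelevant.zipWith (join-isTriword {u = u} {v}) p q

_∧ʰ_ : Tri n → Tri n → Tri n
(u , p) ∧ʰ (v , q) = clear (zipWith _⊓_ u v) , Irrelevant.zipWith (meet-isTriword {u = u} {v}) p q

𝟎 : Tri n
𝟎 {n} = replicate n 0F , [ (λ i _ eq → 0≢2 i eq) , (λ _ _ j _ eq → 0≢1 j eq) ]
  where
  0≢2 : ∀ i → lookup (replicate n (Fin 3 ∋ 0F)) i ≢ 2F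
  0≢2 i eq with trans (sym (Vec.lookup-replicate i (Fin 3 ∋ 0F))) eq
  ... | ()
  0≢1 : ∀ i → lookup (replicate n (Fin 3 ∋ 0F)) i ≢ 1F
  0≢1 i eq with trans (sym (Vec.lookup-replicate i (Fin 3 ∋ 0F))) eq
  ... | ()

≤ʰ-isPartialOrder : IsPartialOrder _≡_ (_≤ʰ_ {n})
≤ʰ-isPartialOrder = record
  { isPreorder = record
    { isEquivalence = isEquivalence
    ; reflexive     = λ { refl → Pointwise.refl Fin.≤-refl }
    ; trans         = Pointwise.trans ℕ.≤-trans
    }
  ; antisym = λ u≤v v≤u → Refinement.value-injective (antisym u≤v v≤u)
  }
  where
  antisym : {u v : Vec (Fin 3) n} → Pointwise Fin._≤_ u v → Pointwise Fin._≤_ v u → u ≡ v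
  antisym Pointwise.[]       Pointwise.[]       = refl
  antisym (p Pointwise.∷ ps) (q Pointwise.∷ qs) =
    cong₂ _∷_ (Fin.≤-antisym p q) (antisym ps qs)

∨ʰ-supremum : Supremum (_≤ʰ_ {n}) _∨ʰ_
∨ʰ-supremum (u , _) (v , _) =
    pointwise (u≤u⊔v u v)
  , pointwise (v≤u⊔v u v)
  , λ z u≤z v≤z → pointwise λ i →
      subst (Fin._≤ lookup (value z) i) (sym (Vec.lookup-zipWith _⊔_ i u v))
        (⊔-lub (Pointwise.lookup u≤z i) (Pointwise.lookup v≤z i))

∧ʰ-infimum : Infimum (_≤ʰ_ {n}) _∧ʰ_
∧ʰ-infimum (u , _) (v , _) =
    pointwise (λ i → ℕ.≤-trans (clear≤ (zipWith _⊓_ u v) i) (u⊓v≤u u v i))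
  , pointwise (λ i → ℕ.≤-trans (clear≤ (zipWith _⊓_ u v) i) (u⊓v≤v u v i))
  , λ z z≤u z≤v → pointwise (clear-greatest (zipWith _⊓_ u v) z λ i →
      subst (lookup (value z) i Fin.≤_) (sym (Vec.lookup-zipWith _⊓_ i u v))
        (⊓-glb (Pointwise.lookup z≤u i) (Pointwise.lookup z≤v i)))

Hoch : ℕ → FiniteLattice
Hoch n = record
  { Carrier   = Tri n
  ; _≤_       = _≤ʰ_
  ; _∨_       = _∨ʰ_
  ; _∧_       = _∧ʰ_
  ; isLattice = record
    { isPartialOrder = ≤ʰ-isPartialOrder
    ; supremum       = ∨ʰ-supremum
    ; infimum        = ∧ʰ-infimum
    }
  ; ⊥         = 𝟎
  ; minimum   = λ u → pointwise λ i →
      subst (Fin._≤ lookup (value u) i) (sym (Vec.lookup-replicate i 0F)) z≤n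
  ; _≟_       = Refinement._≟_ (Vec.≡-dec Fin._≟_)
  ; _≤?_      = λ u v → Pointwise.decidable Fin._≤?_ (value u) (value v)
  ; elements  = triwords n
  ; complete  = λ u → ∈-mapMaybe-toTri⁺ u (words-complete (value u))
  ; unique    = mapMaybe-toTri-unique (words-unique n)
  }

-- A rational-function identity in x and y is expressed at arbitrary elements x, y of an
-- arbitrary commutative ring in which the denominators are invertible; the generic instance
-- is the localisation of ℤ[x,y] at the denominators, a subring of ℚ(x,y).
module Triangles {c ℓ} (R : CommutativeRing c ℓ) where

  open CommutativeRing R
  open import Algebra.Properties.Monoid.Mult +-monoid using () renaming (_×_ to _ℕ×_)
  open import Algebra.Properties.Semiring.Exp semiring public using (_^_)

  infixr 8 _·_

  _·_ : ℤ → Carrier → Carrier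
  (+ k)    · a = k ℕ× a
  -[1+ k ] · a = - (suc k ℕ× a)

  Σ[Tri] : ∀ n → (Tri n → Carrier) → Carrier
  Σ[Tri] n f = foldr _+_ 0# (map f (triwords n))

  M-triangle : ∀ n → (Tri n → ℕ) → (Tri n → Tri n → ℤ) → Carrier → Carrier → Carrier
  M-triangle n rk μ x y = Σ[Tri] n λ u → Σ[Tri] n λ v → μ u v · (x ^ rk u * y ^ rk v)

  -- p and q are to be inverses of y - 1 and x (y - 1) + 1.
  H-triangle : ∀ n → (Tri n → ℕ) → (Tri n → Tri n → ℤ) →
               (x y p q : Carrier) → Carrier
  H-triangle n rk μ x y p q =
    (x * (y - 1#) + 1#) ^ n * M-triangle n rk μ (y * p) (x * (y - 1#) * q)

{-# OPTIONS --safe #-}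

-- Write a triword as 0 ∷ w or 1 ∷ w. It is determined by its set S of twos and its number k of
-- ones, 0 ≤ k ≤ n - |S|; the lower covers show |Can| = |S| + [k > 0] and
-- neg = |S| + [k = 1]. Reading off Ψ, 0 ∷ v ⊑ u iff u has all the twos of v,
-- whereas 1 ∷ v ⊑ u iff u is obtained from 1 ∷ v by turning entries into 2. Hence |Can| is also
-- the rank.
--
-- The values of μ are not needed. By the defining property of μ, Σ_v μ(u,v) F(v) = K(u) as soon
-- as F(v) = Σ_{w ⊒ v} K(w). For F(v) = b ^ rk(v) such a kernel is
-- K = b ^ (|S| + 1) (1 - b) ^ (n - 1 - |S|) at 1 ∷ w and
-- K = b ^ |S| (1 - b) ^ (n - 1 - |S|) (1 - (n - |S|) b) at 0 ∷ w. After this substitution the two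
-- sides of the identity agree already when summed over the triwords with a given S.
module Submission where

open import Defs
open import Algebra.Bundles using (CommutativeRing)
import Algebra.Construct.NaturalChoice.Max as Max
import Algebra.Solver.Ring.NaturalCoefficients.Default as Solver
open import Data.Bool.Base using (if_then_else_; true; false)
open import Data.Empty using (⊥-elim)
open import Data.Fin.Base using (Fin; zero; suc; toℕ; _≤_; _<_)
open import Data.Fin.Patterns using (0F; 1F; 2F)
import Data.Fin.Properties as Fin
open import Data.Integer.Base as ℤ using (ℤ; +_; -[1+_]; 0ℤ; _⊖_)
import Data.Integer.Properties as ℤ
open import Data.Irrelevant using ([_])
open import Data.List.Base as List
  using (List; []; _∷_; _++_; map; foldr; filter; length; mapMaybe; allFin)
open import Data.List.Membership.Propositional using (_∈_)
open import Data.List.Membership.Propositional.Properties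
  using (∈-filter⁺; ∈-filter⁻; ∈-allFin; ∈-map⁺; ∈-map⁻)
open import Data.List.Membership.Propositional.Properties.WithK using (unique∧set⇒bag)
import Data.List.Properties as List
open import Data.List.Relation.Binary.BagAndSetEquality using (∼bag⇒↭)
open import Data.List.Relation.Binary.Permutation.Propositional.Properties using (↭-length)
open import Data.List.Relation.Unary.All as All using (All; []; _∷_)
open import Data.List.Relation.Unary.AllPairs using ([]; _∷_)
open import Data.List.Relation.Unary.Any using (here; there)
open import Data.List.Relation.Unary.Unique.Propositional using (Unique)
import Data.List.Relation.Unary.Unique.Propositional.Properties as Unique
open import Data.Nat.Base as ℕ using (ℕ; zero; suc; z≤n; s≤s; _>_)
import Data.Nat.Properties as ℕ
open import Data.Product.Base using (∃; _×_; _,_; proj₁; proj₂)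
open import Data.Refinement.Base using (value; _,_)
open import Data.Refinement.Properties using (value-injective)
open import Data.Sum.Base using (_⊎_; inj₁; inj₂; [_,_]′; map₁; map₂)
open import Data.Vec.Base using (Vec; []; _∷_; lookup; replicate; tabulate)
import Data.Vec.Properties as Vec
open import Data.Vec.Relation.Binary.Pointwise.Extensional using (ext; extensional⇒inductive)
open import Data.Vec.Relation.Binary.Pointwise.Inductive as Pointwise using (Pointwise; []; _∷_)
open import Function.Base using (id; _∘_; _∋_)
open import Function.Bundles using (mk⇔)
open import Level using (0ℓ)
open import Relation.Binary.Core using (Rel)
open import Relation.Binary.Definitions using (Decidable; DecidableEquality; tri<; tri≈; tri>)
open import Relation.Binary.PropositionalEquality
  using (_≡_; _≢_; refl; sym; trans; cong; cong₂; subst)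
open import Relation.Nullary using (Dec; yes; no; ¬_; ¬?; does; contradiction)
open import Relation.Nullary.Decidable
  using (_×-dec_; _→-dec_; _⊎-dec_; map′; dec-true; dec-false; decidable-stable; does-⇔)
open import Relation.Unary using (Pred)
import Relation.Unary as Unary

open Max (Fin.≤-totalOrder 3) using (_⊔_; ⊔-sel)

-- Every label is either an atom with a single 2, which lies below u iff u has that 2, or a word
-- 1...10...0, which lies below u iff u has no 0 among the places of its ones. By (T3) such a word
-- is the least triword with a 1 at the place of its last 1. Labels of this second kind are the ones
-- by which Ψ can exceed Can.
--
-- The kernel comes from the shape of the order. Above `1 ∷ v` the order is Boolean: each tail entry
-- other than 2 is either kept or turned into 2. Weights b for a 2 and 1 - b for any other entry
-- make each such choice sum to 1. Above `0 ∷ v` only S matters, and each S is shared by n - |S|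
-- triwords that begin with 1; the factor 1 - (n - |S|) b compensates for them.
--
-- The arguments of M fit these weights. Put d = y - 1, X = x d + 1, a = y / d and b = x d / X. Then
-- 1 - b = 1 / X, X a b = x y and X b = x d, so the prefactor X ^ n, one X for each entry, clears
-- every denominator.

private variable
  n : ℕ

-- Covers and the nucleus in a finite lattice.

module FiniteLatticeProperties (L : FiniteLattice) where
  open FiniteLattice L renaming
    (_≤_ to _≤ᴸ_; _≤?_ to _≤ᴸ?_; refl to ≤ᴸ-refl; trans to ≤ᴸ-trans; antisym to ≤ᴸ-antisym)

  -- Makes c a competitor in the minimum that defines the label of the cover; every upper bound on a
  -- label comes from here.
  cover-∨ : ∀ {a b c} → a ⋖ b → c ≤ᴸ b → ¬ c ≤ᴸ a → a ∨ c ≡ b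
  cover-∨ {a} {b} {c} ((a≤b , _) , tight) c≤b c≰a with a ∨ c ≟ b
  ... | yes eq = eq
  ... | no  ≢b = ⊥-elim (tight (a ∨ c)
    ( (x≤x∨y a c , λ a≡a∨c → c≰a (subst (c ≤ᴸ_) (sym a≡a∨c) (y≤x∨y a c)))
    , (∨-least a≤b c≤b , ≢b)))

  private
    foldr-∧-≤ : ∀ a bs → foldr _∧_ a bs ≤ᴸ a
    foldr-∧-≤ a []       = ≤ᴸ-refl
    foldr-∧-≤ a (b ∷ bs) = ≤ᴸ-trans (x∧y≤y b _) (foldr-∧-≤ a bs)

    foldr-∧-lower : ∀ a {b bs} → b ∈ bs → foldr _∧_ a bs ≤ᴸ b
    foldr-∧-lower a (here refl) = x∧y≤x _ _
    foldr-∧-lower a (there b∈)  = ≤ᴸ-trans (x∧y≤y _ _) (foldr-∧-lower a b∈)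

    foldr-∧-greatest : ∀ {a c} bs → c ≤ᴸ a → (∀ {b} → b ∈ bs → c ≤ᴸ b) → c ≤ᴸ foldr _∧_ a bs
    foldr-∧-greatest []       c≤a c≤bs = c≤a
    foldr-∧-greatest (b ∷ bs) c≤a c≤bs =
      ∧-greatest (c≤bs (here refl)) (foldr-∧-greatest bs c≤a λ b∈ → c≤bs (there b∈))

  nucleus-≤ : ∀ a → nucleus a ≤ᴸ a
  nucleus-≤ a = foldr-∧-≤ a (filter (_⋖? a) elements)

  nucleus-lower : ∀ {a b} → b ⋖ a → nucleus a ≤ᴸ b
  nucleus-lower {a} b⋖a = foldr-∧-lower a {bs = filter (_⋖? a) elements}
    (∈-filter⁺ (_⋖? a) (complete _) b⋖a)

  nucleus-greatest : ∀ {a c} → c ≤ᴸ a → (∀ b → b ⋖ a → c ≤ᴸ b) → c ≤ᴸ nucleus a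
  nucleus-greatest {a} c≤a c≤ = foldr-∧-greatest (filter (_⋖? a) elements) c≤a λ b∈ →
    c≤ _ (proj₂ (∈-filter⁻ (_⋖? a) {xs = elements} b∈))

  Can⊆Ψ : ∀ {a c} → Can a c → Ψ a c
  Can⊆Ψ {a} (b , b⋖a , label) = b , a , nucleus-lower b⋖a , b⋖a , ≤ᴸ-refl , label

  ∣∣≡length : {P : Pred Carrier 0ℓ} (P? : Unary.Decidable P) {as : List Carrier} → Unique as →
              (∀ {a} → P a → a ∈ as) → (∀ {a} → a ∈ as → P a) → ∣ P? ∣ ≡ length as
  ∣∣≡length P? !as P⇒∈ ∈⇒P = ↭-length (∼bag⇒↭ (unique∧set⇒bag (Unique.filter⁺ P? unique) !as
    (mk⇔ (λ a∈ → P⇒∈ (proj₂ (∈-filter⁻ P? {xs = elements} a∈)))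
         (λ a∈ → ∈-filter⁺ P? (complete _) (∈⇒P a∈)))))

≡2-mono : {a b : Fin 3} → a ≤ b → a ≡ 2F → b ≡ 2F
≡2-mono {b = 1F} (s≤s ()) refl
≡2-mono {b = 2F} _ refl = refl

≢0-mono : {a b : Fin 3} → a ≤ b → a ≢ 0F → b ≢ 0F
≢0-mono a≤b a≢0 refl = a≢0 (≤0⇒≡0 a≤b)

≢0⇒1≤ : {a : Fin 3} → a ≢ 0F → (Fin 3 ∋ 1F) ≤ a
≢0⇒1≤ {0F} ≢0 = contradiction refl ≢0
≢0⇒1≤ {1F} _  = s≤s z≤n
≢0⇒1≤ {2F} _  = s≤s z≤n

≢0∧≢2⇒≡1 : {a : Fin 3} → a ≢ 0F → a ≢ 2F → a ≡ 1F
≢0∧≢2⇒≡1 {0F} ≢0 _  = contradiction refl ≢0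
≢0∧≢2⇒≡1 {1F} _  _  = refl
≢0∧≢2⇒≡1 {2F} _  ≢2 = contradiction refl ≢2

≢2⇒≤1 : {a : Fin 3} → a ≢ 2F → a ≤ (Fin 3 ∋ 1F)
≢2⇒≤1 {0F} _ = z≤n
≢2⇒≤1 {1F} _ = s≤s z≤n
≢2⇒≤1 {2F} ≢2 = contradiction refl ≢2

-- Labels and canonical join representations

-- An abstract interface, because in Hoch itself the irrelevant component of a triword keeps
-- implicit lattice elements from being inferred.
record Coordinates (L : FiniteLattice) (N : ℕ) : Set where
  open FiniteLattice L renaming (_≤_ to _≤ᴸ_)
  infixl 9 _!_
  field
    _!_         : Carrier → Fin (suc N) → Fin 3
    ≤⇒!≤        : ∀ {u v} → u ≤ᴸ v → ∀ i → u ! i ≤ v ! i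
    !≤⇒≤        : ∀ {u v} → (∀ i → u ! i ≤ v ! i) → u ≤ᴸ v
    ∨-sel       : ∀ u v i {a} → (u ∨ v) ! i ≡ a → u ! i ≡ a ⊎ v ! i ≡ a
    ⊥-!         : ∀ i → ⊥ ! i ≡ 0F
    first≢2     : ∀ u → u ! zero ≢ 2F
    0-before⇒≢1 : ∀ u {i j} → i < j → u ! i ≡ 0F → u ! j ≢ 1F
    fromEntries : (f : Fin (suc N) → Fin 3) → f zero ≢ 2F →
                  (∀ {i j} → i < j → f i ≡ 0F → f j ≢ 1F) → ∃ λ u → ∀ i → u ! i ≡ f i

module Labels {L : FiniteLattice} {N : ℕ} (coordinates : Coordinates L N) where

  open FiniteLattice L renaming
    (_≤_ to _≤ᴸ_; _≤?_ to _≤ᴸ?_; refl to ≤ᴸ-refl; trans to ≤ᴸ-trans; antisym to ≤ᴸ-antisym)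
  open FiniteLatticeProperties L
  open Coordinates coordinates

  private
    T = Carrier
    I = Fin (suc N)

  1-after⇒≢0 : ∀ u {i j} → i ≤ j → u ! j ≡ 1F → u ! i ≢ 0F
  1-after⇒≢0 u {i} {j} i≤j uⱼ≡1 uᵢ≡0 with i Fin.≟ j
  ... | yes refl = contradiction (trans (sym uᵢ≡0) uⱼ≡1) λ ()
  ... | no  i≢j  = 0-before⇒≢1 u (Fin.≤∧≢⇒< i≤j i≢j) uᵢ≡0 uⱼ≡1

  module _ (i : Fin N) where
    private
      entry : I → Fin 3
      entry k = if does (k Fin.≟ suc i) then 2F else 0F

      entry≢1 : ∀ k → entry k ≢ 1F
      entry≢1 k with does (k Fin.≟ suc i)
      ... | true  = λ ()
      ... | false = λ ()

      build : ∃ λ u → ∀ k → u ! k ≡ entry k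
      build = fromEntries entry (λ ()) (λ {_} {j} _ _ → entry≢1 j)

    -- Lying above `twoAt i` amounts to having a 2 at `suc i`, by `twoAt-≤` and `twoAt-≤⁻`. The
    -- index is shifted because the first entry is never 2.
    twoAt : T
    twoAt = proj₁ build

    twoAt-! : twoAt ! suc i ≡ 2F
    twoAt-! rewrite proj₂ build (suc i) | dec-true (suc i Fin.≟ suc i) refl = refl

    twoAt-!-≢ : ∀ {k} → k ≢ suc i → twoAt ! k ≡ 0F
    twoAt-!-≢ {k} k≢i rewrite proj₂ build k | dec-false (k Fin.≟ suc i) k≢i = refl

    twoAt-≤ : ∀ {u} → u ! suc i ≡ 2F → twoAt ≤ᴸ u
    twoAt-≤ {u} uᵢ≡2 = !≤⇒≤ entries
      where
      entries : ∀ k → twoAt ! k ≤ u ! k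
      entries k with k Fin.≟ suc i
      ... | yes refl rewrite uᵢ≡2 = Fin.≤-reflexive twoAt-!
      ... | no  k≢i  rewrite twoAt-!-≢ k≢i = z≤n

    twoAt-≤⁻ : ∀ {u} → twoAt ≤ᴸ u → u ! suc i ≡ 2F
    twoAt-≤⁻ ≤u = ≡2-mono (≤⇒!≤ ≤u (suc i)) twoAt-!

  module _ (j : I) where
    private
      entry : I → Fin 3
      entry k = if does (k Fin.≤? j) then 1F else 0F

      entry≢2 : ∀ k → entry k ≢ 2F
      entry≢2 k with does (k Fin.≤? j)
      ... | true  = λ ()
      ... | false = λ ()

      entry-> : ∀ {k} → ¬ (k ≤ j) → entry k ≡ 0F
      entry-> {k} k≰j rewrite dec-false (k Fin.≤? j) k≰j = refl

      entry-01 : ∀ {i k} → i < k → entry i ≡ 0F → entry k ≢ 1F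
      entry-01 {i} {k} i<k eq eq′ = contradiction (trans (sym entry-≤) eq) λ ()
        where
        k≤j : k ≤ j
        k≤j = decidable-stable (k Fin.≤? j) λ k≰j →
          contradiction (trans (sym (entry-> k≰j)) eq′) λ ()
        entry-≤ : entry i ≡ 1F
        entry-≤ rewrite dec-true (i Fin.≤? j) (ℕ.≤-trans (ℕ.<⇒≤ i<k) k≤j) = refl

      build : ∃ λ u → ∀ k → u ! k ≡ entry k
      build = fromEntries entry (entry≢2 zero) entry-01

    -- The word 1...10...0 with its last 1 at j. Since (T3) forbids a 0 before a 1, it lies below
    -- every triword with a 1 at j.
    oneTo : T
    oneTo = proj₁ build

    oneTo-!-≤ : ∀ {k} → k ≤ j → oneTo ! k ≡ 1F
    oneTo-!-≤ {k} k≤j rewrite proj₂ build k | dec-true (k Fin.≤? j) k≤j = refl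

    oneTo-!-> : ∀ {k} → j < k → oneTo ! k ≡ 0F
    oneTo-!-> {k} j<k
      rewrite proj₂ build k | dec-false (k Fin.≤? j) (ℕ.<⇒≱ j<k) = refl

    oneTo-≤ : ∀ {u} → (∀ {k} → k ≤ j → u ! k ≢ 0F) → oneTo ≤ᴸ u
    oneTo-≤ {u} u≢0 = !≤⇒≤ entries
      where
      entries : ∀ k → oneTo ! k ≤ u ! k
      entries k with k Fin.≤? j
      ... | yes k≤j rewrite oneTo-!-≤ k≤j = ≢0⇒1≤ (u≢0 k≤j)
      ... | no  k≰j rewrite oneTo-!-> (ℕ.≰⇒> k≰j) = z≤n

    oneTo-≤⁻ : ∀ {u} → oneTo ≤ᴸ u → ∀ {k} → k ≤ j → u ! k ≢ 0F
    oneTo-≤⁻ ≤u {k} k≤j = ≢0-mono (≤⇒!≤ ≤u k) λ eq →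
      contradiction (trans (sym (oneTo-!-≤ k≤j)) eq) λ ()

  -- One entry of u is lowered to a. The last two hypotheses are what (T3) asks of the change: no 1
  -- after a new 0, no 0 before a new 1.
  module _ (u : T) (i : I) (a : Fin 3) (a<uᵢ : a < u ! i)
           (0-ok : a ≡ 0F → ∀ {k} → i < k → u ! k ≢ 1F)
           (1-ok : a ≡ 1F → ∀ {k} → k < i → u ! k ≢ 0F) where
    private
      entry : I → Fin 3
      entry k = if does (k Fin.≟ i) then a else u ! k

      entry-≡ : entry i ≡ a
      entry-≡ rewrite dec-true (i Fin.≟ i) refl = refl

      entry-≢ : ∀ {k} → k ≢ i → entry k ≡ u ! k
      entry-≢ {k} k≢i rewrite dec-false (k Fin.≟ i) k≢i = refl

      entry≤ : ∀ k → entry k ≤ u ! k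
      entry≤ k with k Fin.≟ i
      ... | yes refl = ℕ.<⇒≤ a<uᵢ
      ... | no  _    = ℕ.≤-refl

      entry-01 : ∀ {k l} → k < l → entry k ≡ 0F → entry l ≢ 1F
      entry-01 {k} {l} k<l eq eq′ with k Fin.≟ i | l Fin.≟ i
      ... | yes refl | yes refl = ℕ.<-irrefl refl k<l
      ... | yes refl | no _     = 0-ok eq k<l eq′
      ... | no _     | yes refl = 1-ok eq′ k<l eq
      ... | no _     | no _     = 0-before⇒≢1 u k<l eq eq′

      build : ∃ λ v → ∀ k → v ! k ≡ entry k
      build = fromEntries entry (λ eq → first≢2 u (≡2-mono (entry≤ zero) eq)) entry-01

    lower : T
    lower = proj₁ build

    lower-! : lower ! i ≡ a
    lower-! = trans (proj₂ build i) entry-≡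

    lower-!-≢ : ∀ {k} → k ≢ i → lower ! k ≡ u ! k
    lower-!-≢ {k} k≢i = trans (proj₂ build k) (entry-≢ k≢i)

    lower≤ : lower ≤ᴸ u
    lower≤ = !≤⇒≤ λ k → subst (_≤ u ! k) (sym (proj₂ build k)) (entry≤ k)

    private
      lower-!≢u-! : lower ! i ≢ u ! i
      lower-!≢u-! eq = ℕ.<-irrefl (cong toℕ (trans (sym lower-!) eq)) a<uᵢ

    -- The hypothesis ranges over triwords c and not over values: when a 2 is lowered to 0, the
    -- value 1 lies in between, and only (T3) for c rules it out.
    lower-⋖ : (∀ c → (∀ {k} → k ≢ i → c ! k ≡ u ! k) → a ≤ c ! i → c ! i ≤ u ! i →
               c ! i ≡ a ⊎ c ! i ≡ u ! i) → lower ⋖ u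
    lower-⋖ tight = (lower≤ , λ eq → lower-!≢u-! (cong (_! i) eq)) , between
      where
      between : ∀ c → ¬ ((lower ≤ᴸ c × lower ≢ c) × (c ≤ᴸ u × c ≢ u))
      between c ((l≤c , l≢c) , (c≤u , c≢u)) =
        [ (λ cᵢ≡a → l≢c (≤ᴸ-antisym l≤c (!≤⇒≤ λ k → below cᵢ≡a k)))
        , (λ cᵢ≡uᵢ → c≢u (≤ᴸ-antisym c≤u (!≤⇒≤ λ k → above cᵢ≡uᵢ k)))
        ]′ (tight c agree (subst (_≤ c ! i) lower-! (≤⇒!≤ l≤c i)) (≤⇒!≤ c≤u i))
        where
        agree : ∀ {k} → k ≢ i → c ! k ≡ u ! k
        agree {k} k≢i = Fin.≤-antisym (≤⇒!≤ c≤u k) (subst (_≤ c ! k) (lower-!-≢ k≢i) (≤⇒!≤ l≤c k))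
        below : c ! i ≡ a → ∀ k → c ! k ≤ lower ! k
        below cᵢ≡a k with k Fin.≟ i
        ... | yes refl = Fin.≤-reflexive (trans cᵢ≡a (sym lower-!))
        ... | no  k≢i  = Fin.≤-reflexive (trans (agree k≢i) (sym (lower-!-≢ k≢i)))
        above : c ! i ≡ u ! i → ∀ k → u ! k ≤ c ! k
        above cᵢ≡uᵢ k with k Fin.≟ i
        ... | yes refl = Fin.≤-reflexive (sym cᵢ≡uᵢ)
        ... | no  k≢i  = Fin.≤-reflexive (sym (agree k≢i))

    -- A join takes each entry from one of its arguments. So `lower ∨ d` can be u only if d already
    -- has the entry of u at i, and g has to be compared with such d only.
    lower-isLabel : ∀ {g} → lower ⋖ u → g ≤ᴸ u → ¬ (g ≤ᴸ lower) →
                    (∀ {d} → d ≤ᴸ u → d ! i ≡ u ! i → g ≤ᴸ d) → IsLabel lower u g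
    lower-isLabel ⋖u g≤u g≰l least = cover-∨ ⋖u g≤u g≰l , λ d eq →
      least (subst (d ≤ᴸ_) eq (y≤x∨y lower d))
        ([ (λ e → contradiction e lower-!≢u-!) , id ]′ (∨-sel lower d i (cong (_! i) eq)))

  -- Lower covers of a triword and their labels.

  record IsLastOne (u : T) (l : I) : Set where
    constructor _,_
    field
      here≡1  : u ! l ≡ 1F
      after≢1 : ∀ {k} → l < k → u ! k ≢ 1F
  open IsLastOne

  private
    ≤1⇒≡0⊎≡1 : (c : Fin 3) → c ≤ (Fin 3 ∋ 1F) → c ≡ 0F ⊎ c ≡ 1F
    ≤1⇒≡0⊎≡1 0F _ = inj₁ refl
    ≤1⇒≡0⊎≡1 1F _ = inj₂ refl
    ≤1⇒≡0⊎≡1 2F (s≤s ())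

    1≤⇒≡1⊎≡2 : (c : Fin 3) → (Fin 3 ∋ 1F) ≤ c → c ≡ 1F ⊎ c ≡ 2F
    1≤⇒≡1⊎≡2 1F _ = inj₁ refl
    1≤⇒≡1⊎≡2 2F _ = inj₂ refl

    ≢1⇒≡0⊎≡2 : (c : Fin 3) → c ≢ 1F → c ≡ 0F ⊎ c ≡ 2F
    ≢1⇒≡0⊎≡2 0F _ = inj₁ refl
    ≢1⇒≡0⊎≡2 1F ≢ = contradiction refl ≢
    ≢1⇒≡0⊎≡2 2F _ = inj₂ refl

  -- Clearing the last 1 respects (T3), and no value lies between 0 and 1. The label is `oneTo l`
  -- because a triword with a 1 at l has no 0 up to l.
  lastOne-lower : ∀ {u l} → IsLastOne u l → ∃ λ e → e ! l ≡ 0F × e ⋖ u × IsLabel e u (oneTo l)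
  lastOne-lower {u} {l} (uₗ≡1 , after) = e , eₗ≡0 , ⋖u , lower-isLabel u l 0F 0<uₗ ok₀ (λ ()) ⋖u
      (oneTo-≤ l λ k≤l → 1-after⇒≢0 u k≤l uₗ≡1)
      (λ ≤e → oneTo-≤⁻ l ≤e ℕ.≤-refl eₗ≡0)
      (λ {d} d≤u dₗ≡uₗ → oneTo-≤ l λ k≤l → 1-after⇒≢0 d k≤l (trans dₗ≡uₗ uₗ≡1))
    where
    0<uₗ : (Fin 3 ∋ 0F) < u ! l
    0<uₗ rewrite uₗ≡1 = s≤s z≤n
    ok₀ : (Fin 3 ∋ 0F) ≡ 0F → ∀ {k} → l < k → u ! k ≢ 1F
    ok₀ _ = after
    e = lower u l 0F 0<uₗ ok₀ (λ ())
    eₗ≡0 : e ! l ≡ 0F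
    eₗ≡0 = lower-! u l 0F 0<uₗ ok₀ (λ ())
    ⋖u : e ⋖ u
    ⋖u = lower-⋖ u l 0F 0<uₗ ok₀ (λ ()) λ c _ _ c≤u →
      [ inj₁ , (λ c≡1 → inj₂ (trans c≡1 (sym uₗ≡1))) ]′ (≤1⇒≡0⊎≡1 (c ! l) (subst (c ! l ≤_) uₗ≡1 c≤u))

  -- After a 0 the entry 1 is forbidden, so the 2 drops straight to 0; with no 0 before it, it drops
  -- to 1. The label is the same either way.
  two-lower : ∀ {u i} → u ! suc i ≡ 2F → ∃ λ e → e ! suc i ≢ 2F × e ⋖ u × IsLabel e u (twoAt i)
  two-lower {u} {i} uᵢ≡2 = by-cases (Fin.any? λ k → (k Fin.<? suc i) ×-dec (u ! k Fin.≟ 0F))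
    where
    Goal = ∃ λ e → e ! suc i ≢ 2F × e ⋖ u × IsLabel e u (twoAt i)

    lower-to : ∀ a → a < (Fin 3 ∋ 2F) → (a ≡ 0F → ∀ {k} → suc i < k → u ! k ≢ 1F) →
               (a ≡ 1F → ∀ {k} → k < suc i → u ! k ≢ 0F) →
               (∀ c → (∀ {k} → k ≢ suc i → c ! k ≡ u ! k) → a ≤ c ! suc i →
                c ! suc i ≡ a ⊎ c ! suc i ≡ 2F) → Goal
    lower-to a a<2 ok₀ ok₁ tight = e , e≢2 , ⋖u , lower-isLabel u (suc i) a a<u ok₀ ok₁ ⋖u
        (twoAt-≤ i uᵢ≡2) (λ ≤e → e≢2 (twoAt-≤⁻ i ≤e)) (λ _ eq → twoAt-≤ i (trans eq uᵢ≡2))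
      where
      a<u : a < u ! suc i
      a<u = subst (a <_) (sym uᵢ≡2) a<2
      e = lower u (suc i) a a<u ok₀ ok₁
      e≢2 : e ! suc i ≢ 2F
      e≢2 eq = Fin.<⇒≢ a<2 (trans (sym (lower-! u (suc i) a a<u ok₀ ok₁)) eq)
      ⋖u : e ⋖ u
      ⋖u = lower-⋖ u (suc i) a a<u ok₀ ok₁ λ c agree a≤c _ →
        map₂ (λ e → trans e (sym uᵢ≡2)) (tight c agree a≤c)

    by-cases : Dec (∃ λ k → k < suc i × u ! k ≡ 0F) → Goal
    by-cases (yes (k , k<i , uₖ≡0)) = lower-to 0F (s≤s z≤n)
      (λ _ i<l → 0-before⇒≢1 u (ℕ.<-trans k<i i<l) uₖ≡0) (λ ())
      (λ c agree _ → ≢1⇒≡0⊎≡2 (c ! suc i) (0-before⇒≢1 c k<i (trans (agree (Fin.<⇒≢ k<i)) uₖ≡0)))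
    by-cases (no none) = lower-to 1F (s≤s (s≤s z≤n))
      (λ ()) (λ _ k<i uₖ≡0 → none (_ , k<i , uₖ≡0))
      (λ c _ → 1≤⇒≡1⊎≡2 (c ! suc i))

  -- These j turn out to be the ones with `oneTo j` in Ψ u. They run from the last 1 of u to just
  -- before its first 0, so a 2 directly after the last 1 yields a core label that is not a
  -- canonical joinand.
  record Cut (u : T) (j : I) : Set where
    constructor _,_
    field
      before≢0 : ∀ {k} → k ≤ j → u ! k ≢ 0F
      after≢1  : ∀ {k} → j < k → u ! k ≢ 1F

  Can-two : ∀ {u i} → u ! suc i ≡ 2F → Can u (twoAt i)
  Can-two uᵢ≡2 = let e , _ , e⋖u , label = two-lower uᵢ≡2 in e , e⋖u , label

  Can-one : ∀ {u l} → IsLastOne u l → Can u (oneTo l)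
  Can-one last = let e , _ , e⋖u , label = lastOne-lower last in e , e⋖u , label

  -- A 2 of the nucleus is also a 2 of u, but the lower cover from `two-lower` has lost it.
  nucleus≢2 : ∀ u k → nucleus u ! k ≢ 2F
  nucleus≢2 u zero    = first≢2 (nucleus u)
  nucleus≢2 u (suc i) eq =
    let e , e≢2 , e⋖u , _ = two-lower {u} (≡2-mono (≤⇒!≤ (nucleus-≤ u) (suc i)) eq)
    in  e≢2 (≡2-mono (≤⇒!≤ (nucleus-lower e⋖u) (suc i)) eq)

  lastOne : ∀ {u} → u ! zero ≢ 0F → ∃ (IsLastOne u)
  lastOne {u} u₀≢0 =
    [ (λ (l , uₗ≡1 , after) → l , uₗ≡1 , after)
    , (λ none → contradiction (≢0∧≢2⇒≡1 u₀≢0 (first≢2 u)) (none zero)) ]′ (last-1 (u !_))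
    where
    last-1 : ∀ {n} (f : Fin n → Fin 3) →
             (∃ λ l → f l ≡ 1F × (∀ {k} → l < k → f k ≢ 1F)) ⊎ (∀ k → f k ≢ 1F)
    last-1 {zero}  f = inj₂ λ ()
    last-1 {suc n} f with last-1 (f ∘ suc) | f zero Fin.≟ 1F
    ... | inj₁ (l , fₗ≡1 , after) | _ =
      inj₁ (suc l , fₗ≡1 , λ { {zero} () ; {suc k} (s≤s l<k) → after l<k })
    ... | inj₂ none | yes f₀≡1 = inj₁ (zero , f₀≡1 , λ { {zero} () ; {suc k} _ → none k })
    ... | inj₂ none | no  f₀≢1 = inj₂ λ { zero → f₀≢1 ; (suc k) → none k }

  -- The cover that carries the label is the one below `oneTo j` itself. To see that it lies above
  -- the nucleus: the nucleus has no 2, and it has a 0 at the last 1 of u, so by (T3) it vanishes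
  -- from there on, in particular at j.
  Ψ-one : ∀ {u j} → Cut u j → Ψ u (oneTo j)
  Ψ-one {u} {j} (≢0 , ≢1) = from-covers (lastOne {u} (≢0 z≤n)) (lastOne-lower {oneTo j} {j}
      (oneTo-!-≤ j ℕ.≤-refl , λ j<k eq → contradiction (trans (sym (oneTo-!-> j j<k)) eq) λ ()))
   where
   from-covers : ∃ (IsLastOne u) →
                 (∃ λ e → e ! j ≡ 0F × e ⋖ oneTo j × IsLabel e (oneTo j) (oneTo j)) →
                 Ψ u (oneTo j)
   from-covers (l , last) (e , _ , e⋖a , label) =
     e , oneTo j , nucleus≤e , e⋖a , oneTo-≤ j ≢0 , label
    where
    l≤j : l ≤ j
    l≤j = ℕ.≮⇒≥ λ j<l → ≢1 j<l (here≡1 last)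
    nucleusₗ≡0 : nucleus u ! l ≡ 0F
    nucleusₗ≡0 =
      let d , dₗ≡0 , d⋖u , _ = lastOne-lower {u} last
      in  ≤0⇒≡0 (subst (nucleus u ! l ≤_) dₗ≡0 (≤⇒!≤ (nucleus-lower d⋖u) l))
    nucleus≡0 : ∀ {k} → j ≤ k → nucleus u ! k ≡ 0F
    nucleus≡0 {k} j≤k = [ id , (λ eq → contradiction eq (nucleus≢2 u k)) ]′
      (≢1⇒≡0⊎≡2 (nucleus u ! k) λ eq →
        1-after⇒≢0 (nucleus u) (ℕ.≤-trans l≤j j≤k) eq nucleusₗ≡0)
    nucleus≤oneTo : nucleus u ≤ᴸ oneTo j
    nucleus≤oneTo = !≤⇒≤ entries
      where
      entries : ∀ k → nucleus u ! k ≤ oneTo j ! k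
      entries k =
        [ (λ k≤j → subst (nucleus u ! k ≤_) (sym (oneTo-!-≤ j k≤j)) (≢2⇒≤1 (nucleus≢2 u k)))
        , (λ j≤k → subst (_≤ oneTo j ! k) (sym (nucleus≡0 j≤k)) z≤n)
        ]′ (ℕ.≤-total (toℕ k) (toℕ j))
    nucleus≤e : nucleus u ≤ᴸ e
    -- Otherwise e and the nucleus join to `oneTo j`, and minimality of the label puts `oneTo j`
    -- below the nucleus, which has a 0 at j.
    nucleus≤e = decidable-stable (nucleus u ≤ᴸ? e) λ ≰e →
      oneTo-≤⁻ j (proj₂ label _ (cover-∨ e⋖a nucleus≤oneTo ≰e)) ℕ.≤-refl (nucleus≡0 ℕ.≤-refl)

  -- A cover creates a 2 or turns some 0 into 1, since otherwise no entry grows. The matching join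
  -- irreducible is below b′ but not below b, which bounds c from above. Conversely the join of b
  -- and c can take the new entry only from c, which bounds c from below.
  cover-label : ∀ {b b′ c} → b ⋖ b′ → IsLabel b b′ c →
                (∃ λ i → c ≡ twoAt i × b′ ! suc i ≡ 2F) ⊎
                (∃ λ j → c ≡ oneTo j × b ! j ≡ 0F × b′ ! j ≡ 1F)
  cover-label {b} {b′} {c} b⋖b′@((b≤b′ , b≢b′) , _) (b∨c≡b′ , c-least) =
    by-cases (Fin.any? λ i → (b′ ! suc i Fin.≟ 2F) ×-dec ¬? (b ! suc i Fin.≟ 2F))
    where
    from-∨ : ∀ k {a} → b′ ! k ≡ a → b ! k ≢ a → c ! k ≡ a
    from-∨ k eq bₖ≢a = [ (λ e → contradiction e bₖ≢a) , id ]′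
      (∨-sel b c k (trans (cong (_! k) b∨c≡b′) eq))

    by-cases : Dec (∃ λ i → b′ ! suc i ≡ 2F × b ! suc i ≢ 2F) → _
    by-cases (yes (i , b′ᵢ≡2 , bᵢ≢2)) = inj₁ (i ,
      ≤ᴸ-antisym
        (c-least (twoAt i) (cover-∨ b⋖b′ (twoAt-≤ i b′ᵢ≡2) λ ≤b → bᵢ≢2 (twoAt-≤⁻ i ≤b)))
        (twoAt-≤ i (from-∨ (suc i) b′ᵢ≡2 bᵢ≢2)) , b′ᵢ≡2)
    by-cases (no no-new-2) = one (Fin.any? λ j → (b ! j Fin.≟ 0F) ×-dec (b′ ! j Fin.≟ 1F))
      where
      entry-cases : ∀ a a′ → a ≤ a′ → ¬ (a ≡ 0F × a′ ≡ 1F) → (a′ ≡ 2F → a ≡ 2F) → a′ ≤ a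
      entry-cases a  0F _ _ _ = z≤n
      entry-cases 0F 1F _ ≢01 _ = contradiction (refl , refl) ≢01
      entry-cases 1F 1F _ _ _ = s≤s z≤n
      entry-cases 2F 1F _ _ _ = s≤s z≤n
      entry-cases a  2F _ _ 2⇒2 rewrite 2⇒2 refl = ℕ.≤-refl

      2⇒2 : ∀ k → b′ ! k ≡ 2F → b ! k ≡ 2F
      2⇒2 zero    eq = contradiction eq (first≢2 b′)
      2⇒2 (suc i) eq with b ! suc i Fin.≟ 2F
      ... | yes e  = e
      ... | no  ≢2 = contradiction (i , eq , ≢2) no-new-2

      one : Dec (∃ λ j → b ! j ≡ 0F × b′ ! j ≡ 1F) → _
      one (yes (j , bⱼ≡0 , b′ⱼ≡1)) = inj₂ (j ,
        ≤ᴸ-antisym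
          (c-least (oneTo j) (cover-∨ b⋖b′ (oneTo-≤ j λ k≤j → 1-after⇒≢0 b′ k≤j b′ⱼ≡1)
            λ ≤b → oneTo-≤⁻ j ≤b ℕ.≤-refl bⱼ≡0))
          (oneTo-≤ j λ k≤j → 1-after⇒≢0 c k≤j
            (from-∨ j b′ⱼ≡1 λ bⱼ≡1 → contradiction (trans (sym bⱼ≡0) bⱼ≡1) λ ())) ,
        bⱼ≡0 , b′ⱼ≡1)
      one (no none) = contradiction
        (≤ᴸ-antisym b≤b′ (!≤⇒≤ λ k →
          entry-cases (b ! k) (b′ ! k) (≤⇒!≤ b≤b′ k) (λ eqs → none (k , eqs)) (2⇒2 k)))
        b≢b′

  -- If u had a 1 beyond j, then oneTo j would lie below every lower cover of u, hence below the
  -- nucleus and below b, although b has a 0 at j.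
  new-one⇒Cut : ∀ {u b b′ j} → nucleus u ≤ᴸ b → b′ ≤ᴸ u → b ! j ≡ 0F → b′ ! j ≡ 1F → Cut u j
  new-one⇒Cut {u} {b} {b′} {j} nuc≤b b′≤u bⱼ≡0 b′ⱼ≡1 = ≢0 , λ j<k uₖ≡1 →
      oneTo-≤⁻ j (≤ᴸ-trans (nucleus-greatest (oneTo-≤ j ≢0) (below-covers j<k uₖ≡1)) nuc≤b)
        ℕ.≤-refl bⱼ≡0
    where
    ≢0 : ∀ {k} → k ≤ j → u ! k ≢ 0F
    ≢0 {k} k≤j = ≢0-mono (≤⇒!≤ b′≤u k) (1-after⇒≢0 b′ k≤j b′ⱼ≡1)

    below-covers : ∀ {k} → j < k → u ! k ≡ 1F → ∀ e → e ⋖ u → oneTo j ≤ᴸ e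
    below-covers {k} j<k uₖ≡1 e e⋖u = decidable-stable (oneTo j ≤ᴸ? e) λ ≰e → ≰e
      (oneTo-≤ j λ {m} m≤j → 1-after⇒≢0 e (ℕ.≤-trans m≤j (ℕ.<⇒≤ j<k))
        ([ id , (λ eq → contradiction (trans (sym (oneTo-!-> j j<k)) eq) λ ()) ]′
          (∨-sel e (oneTo j) k (trans (cong (_! k) (cover-∨ e⋖u (oneTo-≤ j ≢0) ≰e)) uₖ≡1))))

  -- When the cover ends at u itself, u has a 1 at the cut, and this is then the last 1.
  Can⁻ : ∀ {u c} → Can u c →
         (∃ λ i → c ≡ twoAt i × u ! suc i ≡ 2F) ⊎ (∃ λ l → c ≡ oneTo l × IsLastOne u l)
  Can⁻ {u} (b , b⋖u , label) with cover-label b⋖u label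
  ... | inj₁ two = inj₁ two
  ... | inj₂ (l , c≡ , bₗ≡0 , uₗ≡1) = inj₂ (l , c≡ , uₗ≡1 ,
    Cut.after≢1 (new-one⇒Cut {u} (nucleus-lower b⋖u) ≤ᴸ-refl bₗ≡0 uₗ≡1))

  Ψ⁻ : ∀ {u c} → Ψ u c →
       (∃ λ i → c ≡ twoAt i × u ! suc i ≡ 2F) ⊎ (∃ λ j → c ≡ oneTo j × Cut u j)
  Ψ⁻ {u} (b , b′ , nuc≤b , b⋖b′ , b′≤u , label) with cover-label b⋖b′ label
  ... | inj₁ (i , c≡ , b′ᵢ≡2) = inj₁ (i , c≡ , ≡2-mono (≤⇒!≤ b′≤u (suc i)) b′ᵢ≡2)
  ... | inj₂ (j , c≡ , bⱼ≡0 , b′ⱼ≡1) = inj₂ (j , c≡ , new-one⇒Cut nuc≤b b′≤u bⱼ≡0 b′ⱼ≡1)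

  twoAt-injective : ∀ {i j} → twoAt i ≡ twoAt j → i ≡ j
  twoAt-injective {i} {j} eq with i Fin.≟ j
  ... | yes i≡j = i≡j
  ... | no  i≢j = contradiction
    (trans (sym (twoAt-! i)) (trans (cong (_! suc i) eq) (twoAt-!-≢ j (i≢j ∘ Fin.suc-injective))))
    λ ()

  oneTo-injective : ∀ {i j} → oneTo i ≡ oneTo j → i ≡ j
  oneTo-injective eq = Fin.≤-antisym (oneTo-mono⁻ eq) (oneTo-mono⁻ (sym eq))
    where
    oneTo-mono⁻ : ∀ {i j} → oneTo i ≡ oneTo j → i ≤ j
    oneTo-mono⁻ {i} {j} eq = ℕ.≮⇒≥ λ j<i → contradiction
      (trans (sym (oneTo-!-≤ i ℕ.≤-refl)) (trans (cong (_! i) eq) (oneTo-!-> j j<i))) λ ()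

  twoAt≢oneTo : ∀ {i j} → twoAt i ≢ oneTo j
  twoAt≢oneTo {i} {j} eq = contradiction
    (trans (sym (twoAt-!-≢ i λ ())) (trans (cong (_! zero) eq) (oneTo-!-≤ j z≤n))) λ ()

  Ψ-two⁻ : ∀ {u i} → Ψ u (twoAt i) → u ! suc i ≡ 2F
  Ψ-two⁻ {u} {i} Ψ-two with Ψ⁻ Ψ-two
  ... | inj₁ (i′ , eq , uᵢ≡2) =
    subst (λ k → u ! suc k ≡ 2F) (sym (twoAt-injective {i} {i′} eq)) uᵢ≡2
  ... | inj₂ (j , eq , _)    = contradiction eq twoAt≢oneTo

  Ψ-one⁻ : ∀ {u j} → Ψ u (oneTo j) → Cut u j
  Ψ-one⁻ {u} {j} Ψ-one with Ψ⁻ Ψ-one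
  ... | inj₁ (i , eq , _)   = contradiction (sym eq) twoAt≢oneTo
  ... | inj₂ (j′ , eq , cut) = subst (Cut u) (sym (oneTo-injective {j} {j′} eq)) cut

  ≡0⇒≡⊥ : ∀ {u} → (∀ k → u ! k ≡ 0F) → u ≡ ⊥
  ≡0⇒≡⊥ u≡0 = ≤ᴸ-antisym
    (!≤⇒≤ λ k → Fin.≤-reflexive (trans (u≡0 k) (sym (⊥-! k)))) (minimum _)

  ⊥≢twoAt : ∀ {i} → ⊥ ≢ twoAt i
  ⊥≢twoAt {i} eq = contradiction
    (trans (sym (⊥-! (suc i))) (trans (cong (_! suc i) eq) (twoAt-! i))) λ ()

  ⊥≢oneTo : ∀ {j} → ⊥ ≢ oneTo j
  ⊥≢oneTo {j} eq = contradiction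
    (trans (sym (⊥-! j)) (trans (cong (_! j) eq) (oneTo-!-≤ j ℕ.≤-refl))) λ ()

  -- An element in between starts with 0, so (T3) keeps its entry at `suc i` from being 1.
  atom-twoAt : ∀ i → Atom (twoAt i)
  atom-twoAt i = (minimum (twoAt i) , ⊥≢twoAt) , between
    where
    between : ∀ c → ¬ ((⊥ ≤ᴸ c × ⊥ ≢ c) × (c ≤ᴸ twoAt i × c ≢ twoAt i))
    between c ((_ , 0≢c) , (c≤ , c≢)) with ≢1⇒≡0⊎≡2 (c ! suc i) (0-before⇒≢1 c (s≤s z≤n) c₀≡0)
      where
      c₀≡0 : c ! zero ≡ 0F
      c₀≡0 = ≤0⇒≡0 (subst (c ! zero ≤_) (twoAt-!-≢ i λ ()) (≤⇒!≤ c≤ zero))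
    ... | inj₂ cᵢ≡2 = c≢ (≤ᴸ-antisym c≤ (twoAt-≤ i cᵢ≡2))
    ... | inj₁ cᵢ≡0 = 0≢c (sym (≡0⇒≡⊥ c≡0))
      where
      c≡0 : ∀ k → c ! k ≡ 0F
      c≡0 k with k Fin.≟ suc i
      ... | yes refl = cᵢ≡0
      ... | no  k≢i  = ≤0⇒≡0 (subst (c ! k ≤_) (twoAt-!-≢ i k≢i) (≤⇒!≤ c≤ k))

  atom-oneTo-zero : Atom (oneTo zero)
  atom-oneTo-zero = (minimum (oneTo zero) , ⊥≢oneTo) , between
    where
    between : ∀ c → ¬ ((⊥ ≤ᴸ c × ⊥ ≢ c) × (c ≤ᴸ oneTo zero × c ≢ oneTo zero))
    between c ((_ , 0≢c) , (c≤ , c≢)) with c ! zero Fin.≟ 0F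
    ... | no  c₀≢0 = c≢ (≤ᴸ-antisym c≤ (oneTo-≤ zero λ { {zero} _ → c₀≢0 ; {suc _} () }))
    ... | yes c₀≡0 = 0≢c (sym (≡0⇒≡⊥ λ
      { zero    → c₀≡0
      ; (suc k) → ≤0⇒≡0 (subst (c ! suc k ≤_) (oneTo-!-> zero (s≤s z≤n)) (≤⇒!≤ c≤ (suc k))) }))

  ¬atom-oneTo-suc : ∀ {j} → ¬ Atom (oneTo (suc j))
  ¬atom-oneTo-suc {j} (_ , tight) = tight (oneTo zero)
    ( (minimum (oneTo zero) , ⊥≢oneTo)
    , (oneTo-≤ zero λ k≤0 → oneTo-≤⁻ (suc j) ≤ᴸ-refl (ℕ.≤-trans k≤0 z≤n))
    , λ eq → contradiction (oneTo-injective eq) λ ())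

  -- The core label order read off from the entries.

  Subordinate : T → T → Set
  Subordinate u v = (u ! zero ≡ 0F × (∀ i → u ! suc i ≡ 2F → v ! suc i ≡ 2F)) ⊎
                    (u ! zero ≡ 1F × v ! zero ≡ 1F × (∀ i → v ! i ≡ 2F ⊎ u ! i ≡ v ! i))

  -- Testing the canonical joinands of u is enough. If l is the last 1 of u, then `oneTo l` in Ψ v
  -- leaves v without a 0 up to l and without a 1 after l. As u has no 0 up to l and no 1 after l
  -- either, each entry of v is 2 or that of u.
  ⊑⇒Subordinate : ∀ {u v} → u ⊑ v → Subordinate u v
  ⊑⇒Subordinate {u} {v} u⊑v = by-first (u ! zero Fin.≟ 0F)
    where
    two⇒two : ∀ i → u ! suc i ≡ 2F → v ! suc i ≡ 2F
    two⇒two i uᵢ≡2 = Ψ-two⁻ (u⊑v (Can⊆Ψ (Can-two uᵢ≡2)))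

    by-first : Dec (u ! zero ≡ 0F) → Subordinate u v
    by-first (yes u₀≡0) = inj₁ (u₀≡0 , two⇒two)
    by-first (no  u₀≢0) = inj₂ (≢0∧≢2⇒≡1 u₀≢0 (first≢2 u) , v₀≡1 , entries)
      where
      l    = proj₁ (lastOne {u} u₀≢0)
      last = proj₂ (lastOne {u} u₀≢0)
      cut : Cut v l
      cut = Ψ-one⁻ (u⊑v (Can⊆Ψ (Can-one last)))

      v₀≡1 : v ! zero ≡ 1F
      v₀≡1 = ≢0∧≢2⇒≡1 (Cut.before≢0 cut z≤n) (first≢2 v)

      entry : ∀ i a → u ! i ≡ a → v ! i ≡ 2F ⊎ a ≡ v ! i
      entry i 0F uᵢ≡0 = [ (λ eq → inj₂ (sym eq)) , inj₁ ]′ (≢1⇒≡0⊎≡2 (v ! i) (Cut.after≢1 cut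
        (ℕ.≰⇒> λ i≤l → 1-after⇒≢0 u i≤l (here≡1 last) uᵢ≡0)))
      entry i 1F uᵢ≡1 = [ (λ eq → inj₂ (sym eq)) , inj₁ ]′ (1≤⇒≡1⊎≡2 (v ! i) (≢0⇒1≤ (Cut.before≢0 cut
        (ℕ.≮⇒≥ λ l<i → after≢1 last l<i uᵢ≡1))))
      entry zero    2F u₀≡2 = contradiction u₀≡2 (first≢2 u)
      entry (suc i) 2F uᵢ≡2 = inj₁ (two⇒two i uᵢ≡2)

      entries : ∀ i → v ! i ≡ 2F ⊎ u ! i ≡ v ! i
      entries i = entry i (u ! i) refl

  -- Turning entries into 2 creates neither a 0 nor a 1, so every cut of u remains a cut; and a word
  -- that starts with 0 has no cut.
  Subordinate⇒⊑ : ∀ {u v} → Subordinate u v → u ⊑ v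
  Subordinate⇒⊑ {u} {v} sub = [ (λ { (i , refl , uᵢ≡2) → Can⊆Ψ (Can-two (two⇒two sub i uᵢ≡2)) })
                              , (λ { (j , refl , cut)  → Ψ-one (cut⇒cut sub cut) }) ]′ ∘ Ψ⁻
    where
    two⇒two : Subordinate u v → ∀ i → u ! suc i ≡ 2F → v ! suc i ≡ 2F
    two⇒two (inj₁ (_ , 2⇒2))         i uᵢ≡2 = 2⇒2 i uᵢ≡2
    two⇒two (inj₂ (_ , _ , entries)) i uᵢ≡2 =
      [ id , (λ eq → trans (sym eq) uᵢ≡2) ]′ (entries (suc i))

    cut⇒cut : ∀ {j} → Subordinate u v → Cut u j → Cut v j
    cut⇒cut (inj₁ (u₀≡0 , _))        (≢0 , _)  = contradiction u₀≡0 (≢0 z≤n)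
    cut⇒cut (inj₂ (_ , _ , entries)) (≢0 , ≢1) =
      (λ {k} k≤j vₖ≡0 → [ (λ vₖ≡2 → contradiction (trans (sym vₖ≡0) vₖ≡2) λ ())
                        , (λ eq → ≢0 k≤j (trans eq vₖ≡0)) ]′ (entries k)) ,
      (λ {k} j<k vₖ≡1 → [ (λ vₖ≡2 → contradiction (trans (sym vₖ≡1) vₖ≡2) λ ())
                        , (λ eq → ≢1 j<k (trans eq vₖ≡1)) ]′ (entries k))

  -- Counting the canonical joinands and the atoms among them.

  private
    twoIndices : T → List (Fin N)
    twoIndices u = filter (λ i → u ! suc i Fin.≟ 2F) (allFin N)

    twoLabels : T → List T
    twoLabels u = map twoAt (twoIndices u)

    ∈-twoLabels⁺ : ∀ {u i} → u ! suc i ≡ 2F → twoAt i ∈ twoLabels u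
    ∈-twoLabels⁺ {u} {i} uᵢ≡2 =
      ∈-map⁺ twoAt (∈-filter⁺ (λ i → u ! suc i Fin.≟ 2F) (∈-allFin i) uᵢ≡2)

    ∈-twoLabels⁻ : ∀ {u c} → c ∈ twoLabels u → ∃ λ i → c ≡ twoAt i × u ! suc i ≡ 2F
    ∈-twoLabels⁻ {u} c∈ =
      let i , i∈ , eq = ∈-map⁻ twoAt c∈
      in  i , eq , proj₂ (∈-filter⁻ (λ i → u ! suc i Fin.≟ 2F) {xs = allFin N} i∈)

    twoLabels-unique : ∀ u → Unique (twoLabels u)
    twoLabels-unique u =
      Unique.map⁺ twoAt-injective (Unique.filter⁺ (λ i → u ! suc i Fin.≟ 2F) (Unique.allFin⁺ N))

    oneTo∷twoLabels-unique : ∀ u j → Unique (oneTo j ∷ twoLabels u)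
    oneTo∷twoLabels-unique u j = All.tabulate
      (λ c∈ eq → let i , c≡ , _ = ∈-twoLabels⁻ {u} c∈ in twoAt≢oneTo (sym (trans eq c≡)))
      ∷ twoLabels-unique u

    Can-∈twoLabels : ∀ {u c} → c ∈ twoLabels u → Can u c
    Can-∈twoLabels {u} c∈ with _ , refl , uᵢ≡2 ← ∈-twoLabels⁻ {u} c∈ = Can-two uᵢ≡2

    Atom-∈twoLabels : ∀ {u c} → c ∈ twoLabels u → Atom c
    Atom-∈twoLabels {u} c∈ with i , refl , _ ← ∈-twoLabels⁻ {u} c∈ = atom-twoAt i

    IsLastOne-unique : ∀ {u l m} → IsLastOne u l → IsLastOne u m → l ≡ m
    IsLastOne-unique {l = l} {m} last-l last-m with Fin.<-cmp l m
    ... | tri< l<m _ _ = contradiction (here≡1 last-m) (after≢1 last-l l<m)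
    ... | tri≈ _ eq _  = eq
    ... | tri> _ _ m<l = contradiction (here≡1 last-l) (after≢1 last-m m<l)

    ¬IsLastOne : ∀ {u l} → u ! zero ≡ 0F → ¬ IsLastOne u l
    ¬IsLastOne {u} u₀≡0 last = 1-after⇒≢0 u z≤n (here≡1 last) u₀≡0

    length-twoLabels : ∀ u → length (twoLabels u) ≡ length (twoIndices u)
    length-twoLabels u = List.length-map twoAt (twoIndices u)

  #twos : T → ℕ
  #twos u = length (twoIndices u)

  ∣Can∣-zero : ∀ {u} → u ! zero ≡ 0F → ∣Can∣ u ≡ #twos u
  ∣Can∣-zero {u} u₀≡0 = trans
    (∣∣≡length (can? u) (twoLabels-unique u)
      (λ can → [ (λ { (i , refl , uᵢ≡2) → ∈-twoLabels⁺ uᵢ≡2 })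
               , (λ (l , _ , last) → contradiction last (¬IsLastOne u₀≡0)) ]′ (Can⁻ can))
      Can-∈twoLabels)
    (length-twoLabels u)

  ∣Can∣-one : ∀ {u l} → IsLastOne u l → ∣Can∣ u ≡ suc (#twos u)
  ∣Can∣-one {u} {l} last = trans
    (∣∣≡length (can? u) (oneTo∷twoLabels-unique u l)
      (λ can → [ (λ { (i , refl , uᵢ≡2) → there (∈-twoLabels⁺ uᵢ≡2) })
               , (λ { (m , refl , last′) → here (cong oneTo (IsLastOne-unique last′ last)) }) ]′
               (Can⁻ can))
      (λ { (here refl) → Can-one last ; (there c∈) → Can-∈twoLabels c∈ }))
    (cong suc (length-twoLabels u))

  neg-one : ∀ {u} → IsLastOne u zero → neg u ≡ suc (#twos u)
  neg-one {u} last = trans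
    (∣∣≡length (λ c → can? u c ×-dec atom? c) (oneTo∷twoLabels-unique u zero)
      (λ (can , _) → [ (λ { (i , refl , uᵢ≡2) → there (∈-twoLabels⁺ uᵢ≡2) })
               , (λ { (m , refl , last′) → here (cong oneTo (IsLastOne-unique last′ last)) }) ]′
               (Can⁻ can))
      (λ { (here refl) → Can-one last , atom-oneTo-zero
         ; (there c∈) → Can-∈twoLabels c∈ , Atom-∈twoLabels {u} c∈ }))
    (cong suc (length-twoLabels u))

  -- Two situations at once: there is no 1 at all, or the last 1 is not the first entry, and then
  -- its label has `oneTo zero` strictly below it and is no atom.
  neg-otherwise : ∀ {u} → ¬ IsLastOne u zero → neg u ≡ #twos u
  neg-otherwise {u} ¬last = trans
    (∣∣≡length (λ c → can? u c ×-dec atom? c) (twoLabels-unique u)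
      (λ (can , atom) → [ (λ { (i , refl , uᵢ≡2) → ∈-twoLabels⁺ uᵢ≡2 })
               , (λ { (zero  , refl , last) → contradiction last ¬last
                    ; (suc l , refl , last) → contradiction atom ¬atom-oneTo-suc }) ]′
               (Can⁻ can))
      (λ c∈ → Can-∈twoLabels c∈ , Atom-∈twoLabels {u} c∈))
    (length-twoLabels u)

-- The core label order on words

Word : ℕ → Set
Word = Vec (Fin 3)

-- The words w for which 0 ∷ w, respectively 1 ∷ w, is a triword.
data ZeroTail : ∀ {n} → Word n → Set where
  []  : ZeroTail []
  0∷_ : ∀ {n} {w : Word n} → ZeroTail w → ZeroTail (0F ∷ w)
  2∷_ : ∀ {n} {w : Word n} → ZeroTail w → ZeroTail (2F ∷ w)

data OneTail : ∀ {n} → Word n → Set where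
  []  : OneTail []
  0∷_ : ∀ {n} {w : Word n} → ZeroTail w → OneTail (0F ∷ w)
  1∷_ : ∀ {n} {w : Word n} → OneTail w → OneTail (1F ∷ w)
  2∷_ : ∀ {n} {w : Word n} → OneTail w → OneTail (2F ∷ w)

private variable
  v w : Word n

zeroTail : (∀ k → lookup w k ≢ 1F) → ZeroTail w
zeroTail {w = []}     _  = []
zeroTail {w = 0F ∷ w} ≢1 = 0∷ zeroTail (≢1 ∘ suc)
zeroTail {w = 1F ∷ w} ≢1 = contradiction refl (≢1 zero)
zeroTail {w = 2F ∷ w} ≢1 = 2∷ zeroTail (≢1 ∘ suc)

zeroTail⁻ : ZeroTail w → ∀ k → lookup w k ≢ 1F
zeroTail⁻ (0∷ z) zero    ()
zeroTail⁻ (0∷ z) (suc k) = zeroTail⁻ z k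
zeroTail⁻ (2∷ z) zero    ()
zeroTail⁻ (2∷ z) (suc k) = zeroTail⁻ z k

oneTail : (∀ i → lookup w i ≡ 0F → ∀ j → i < j → lookup w j ≢ 1F) → OneTail w
oneTail {w = []}     _  = []
oneTail {w = 0F ∷ w} t₃ = 0∷ zeroTail λ k → t₃ zero refl (suc k) (s≤s z≤n)
oneTail {w = 1F ∷ w} t₃ = 1∷ oneTail λ i eq j i<j → t₃ (suc i) eq (suc j) (s≤s i<j)
oneTail {w = 2F ∷ w} t₃ = 2∷ oneTail λ i eq j i<j → t₃ (suc i) eq (suc j) (s≤s i<j)

oneTail⁻ : OneTail w → ∀ i → lookup w i ≡ 0F → ∀ j → i < j → lookup w j ≢ 1F
oneTail⁻ (0∷ z) i       eq (suc j) _         = zeroTail⁻ z j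
oneTail⁻ (1∷ o) (suc i) eq (suc j) (s≤s i<j) = oneTail⁻ o i eq j i<j
oneTail⁻ (2∷ o) (suc i) eq (suc j) (s≤s i<j) = oneTail⁻ o i eq j i<j

0∷-isTriword : ZeroTail w → IsTriword (0F ∷ w)
0∷-isTriword z =
  (λ { zero _ () ; (suc _) () }) ,
  λ { i _ zero () ; i _ (suc j) _ → zeroTail⁻ z j }

1∷-isTriword : OneTail w → IsTriword (1F ∷ w)
1∷-isTriword o =
  (λ { zero _ () ; (suc _) () }) ,
  λ { zero () ; (suc i) _ zero () ; (suc i) eq (suc j) (s≤s i<j) → oneTail⁻ o i eq j i<j }

0∷-isTriword⁻ : IsTriword (0F ∷ w) → ZeroTail w
0∷-isTriword⁻ (_ , t₃) = zeroTail λ k → t₃ zero refl (suc k) (s≤s z≤n)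

1∷-isTriword⁻ : IsTriword (1F ∷ w) → OneTail w
1∷-isTriword⁻ (_ , t₃) = oneTail λ i eq j i<j → t₃ (suc i) eq (suc j) (s≤s i<j)

2∷-¬isTriword : ¬ IsTriword (2F ∷ w)
2∷-¬isTriword (t₂ , _) = t₂ zero refl refl

ZeroTail⇒OneTail : ZeroTail w → OneTail w
ZeroTail⇒OneTail []     = []
ZeroTail⇒OneTail (0∷ z) = 0∷ z
ZeroTail⇒OneTail (2∷ z) = 2∷ ZeroTail⇒OneTail z

twos others : Word n → ℕ
twos []       = 0
twos (0F ∷ w) = twos w
twos (1F ∷ w) = twos w
twos (2F ∷ w) = suc (twos w)
others []       = 0
others (0F ∷ w) = suc (others w)
others (1F ∷ w) = suc (others w)
others (2F ∷ w) = others w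

-- An Iverson bracket that serves as an exponent of y: for `1 ∷ w` it is the summand [k = 1] of
-- `neg`.
[no-1] : Word n → ℕ
[no-1] []       = 1
[no-1] (0F ∷ w) = [no-1] w
[no-1] (1F ∷ w) = 0
[no-1] (2F ∷ w) = [no-1] w

-- The values at 2 ∷ w, which is never a triword, are junk, as for atomicity and kernel below.
height : Word (suc n) → ℕ
height (0F ∷ w) = twos w
height (1F ∷ w) = suc (twos w)
height (2F ∷ w) = twos w

infix 4 _⊆₂_ _≼_ _⊴_

_⊆₂_ _≼_ : Word n → Word n → Set
_⊆₂_ = Pointwise λ a b → a ≡ 2F → b ≡ 2F
_≼_  = Pointwise λ a b → b ≡ 2F ⊎ a ≡ b

data _⊴_ : Word (suc n) → Word (suc n) → Set where
  0∷_ : ∀ {b} → v ⊆₂ w → (0F ∷ v) ⊴ (b ∷ w)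
  1∷_ : v ≼ w → (1F ∷ v) ⊴ (1F ∷ w)

≼⇒⊆₂ : v ≼ w → v ⊆₂ w
≼⇒⊆₂ = Pointwise.map λ { (inj₁ eq) _ → eq ; (inj₂ refl) eq → eq }

-- Without 1s, two entries that both differ from 2 are both 0.
⊆₂⇒≼ : ZeroTail v → ZeroTail w → v ⊆₂ w → v ≼ w
⊆₂⇒≼ []     []      []      = []
⊆₂⇒≼ (0∷ z) (0∷ z′) (_ ∷ s) = inj₂ refl ∷ ⊆₂⇒≼ z z′ s
⊆₂⇒≼ (0∷ z) (2∷ z′) (_ ∷ s) = inj₁ refl ∷ ⊆₂⇒≼ z z′ s
⊆₂⇒≼ (2∷ z) (0∷ z′) (p ∷ s) = contradiction (p refl) λ ()
⊆₂⇒≼ (2∷ z) (2∷ z′) (_ ∷ s) = inj₁ refl ∷ ⊆₂⇒≼ z z′ s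

≼-refl : v ≼ v
≼-refl = Pointwise.refl (inj₂ refl)

⊆₂-refl : v ⊆₂ v
⊆₂-refl = Pointwise.refl id

twos-mono : v ⊆₂ w → twos v ℕ.≤ twos w
twos-mono [] = z≤n
twos-mono (_∷_ {x = 0F} {y = 0F} _ s) = twos-mono s
twos-mono (_∷_ {x = 0F} {y = 1F} _ s) = twos-mono s
twos-mono (_∷_ {x = 0F} {y = 2F} _ s) = ℕ.m≤n⇒m≤1+n (twos-mono s)
twos-mono (_∷_ {x = 1F} {y = 0F} _ s) = twos-mono s
twos-mono (_∷_ {x = 1F} {y = 1F} _ s) = twos-mono s
twos-mono (_∷_ {x = 1F} {y = 2F} _ s) = ℕ.m≤n⇒m≤1+n (twos-mono s)
twos-mono (_∷_ {x = 2F} {y = 2F} _ s) = s≤s (twos-mono s)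
twos-mono (_∷_ {x = 2F} {y = 0F} p s) = contradiction (p refl) λ ()
twos-mono (_∷_ {x = 2F} {y = 1F} p s) = contradiction (p refl) λ ()

∷-strict : ∀ a → v ≡ w ⊎ twos v ℕ.< twos w → a ∷ v ≡ a ∷ w ⊎ twos (a ∷ v) ℕ.< twos (a ∷ w)
∷-strict a  (inj₁ eq) = inj₁ (cong (a ∷_) eq)
∷-strict 0F (inj₂ lt) = inj₂ lt
∷-strict 1F (inj₂ lt) = inj₂ lt
∷-strict 2F (inj₂ lt) = inj₂ (s≤s lt)

≼-strict : v ≼ w → v ≡ w ⊎ twos v ℕ.< twos w
≼-strict []                            = inj₁ refl
≼-strict (_∷_ {x = 0F} (inj₁ refl) s) = inj₂ (s≤s (twos-mono (≼⇒⊆₂ s)))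
≼-strict (_∷_ {x = 1F} (inj₁ refl) s) = inj₂ (s≤s (twos-mono (≼⇒⊆₂ s)))
≼-strict (_∷_ {x = 2F} (inj₁ refl) s) = ∷-strict 2F (≼-strict s)
≼-strict (_∷_ {x = a}  (inj₂ refl) s) = ∷-strict a (≼-strict s)

-- This dichotomy yields the antisymmetry of `⊑`, and it leaves no room between elements whose
-- heights differ by one.
⊴-strict : {v w : Word (suc n)} → IsTriword v → IsTriword w → v ⊴ w →
           v ≡ w ⊎ height v ℕ.< height w
⊴-strict tv tw (0∷_ {b = 0F} s)
  with ≼-strict (⊆₂⇒≼ (0∷-isTriword⁻ tv) (0∷-isTriword⁻ tw) s)
... | inj₁ refl = inj₁ refl
... | inj₂ lt   = inj₂ lt
⊴-strict tv tw (0∷_ {b = 1F} s) = inj₂ (s≤s (twos-mono s))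
⊴-strict tv tw (0∷_ {b = 2F} s) = contradiction tw 2∷-¬isTriword
⊴-strict tv tw (1∷ s) with ≼-strict s
... | inj₁ refl = inj₁ refl
... | inj₂ lt   = inj₂ (s≤s lt)

zeroTail-lower : ∀ {m} → ZeroTail w → twos w ≡ suc m →
                 ∃ λ v → ZeroTail v × v ≼ w × twos v ≡ m
zeroTail-lower (0∷ z) eq with zeroTail-lower z eq
... | v , zv , v≼w , eq′ = 0F ∷ v , 0∷ zv , inj₂ refl ∷ v≼w , eq′
zeroTail-lower (2∷_ {w = w} z) eq = 0F ∷ w , 0∷ z , inj₁ refl ∷ ≼-refl , ℕ.suc-injective eq

-- To keep (T3), a 2 before the first 0 becomes 1 and a 2 after it becomes 0.
oneTail-lower : ∀ {m} → OneTail w → twos w ≡ suc m →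
                ∃ λ v → OneTail v × v ≼ w × twos v ≡ m
oneTail-lower (0∷ z) eq with zeroTail-lower z eq
... | v , zv , v≼w , eq′ = 0F ∷ v , 0∷ zv , inj₂ refl ∷ v≼w , eq′
oneTail-lower (1∷ o) eq with oneTail-lower o eq
... | v , ov , v≼w , eq′ = 1F ∷ v , 1∷ ov , inj₂ refl ∷ v≼w , eq′
oneTail-lower (2∷_ {w = w} o) eq = 1F ∷ w , 1∷ o , inj₁ refl ∷ ≼-refl , ℕ.suc-injective eq

twos-0s : ∀ n → twos (replicate n (Fin 3 ∋ 0F)) ≡ 0
twos-0s zero    = refl
twos-0s (suc n) = twos-0s n

0s-⊆₂ : ∀ {n} {w : Word n} → replicate n 0F ⊆₂ w
0s-⊆₂ {w = []}    = []
0s-⊆₂ {w = _ ∷ w} = (λ ()) ∷ 0s-⊆₂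

zeroTail-0s : ∀ {n} {w : Word n} → ZeroTail w → twos w ≡ 0 → w ≡ replicate n 0F
zeroTail-0s []     _  = refl
zeroTail-0s (0∷ z) eq = cong (0F ∷_) (zeroTail-0s z eq)

⊴-lower : ∀ {m} {w : Word (suc n)} → IsTriword w → height w ≡ suc m →
          ∃ λ v → IsTriword v × v ⊴ w × height v ≡ m
⊴-lower {w = 0F ∷ w} t eq with zeroTail-lower (0∷-isTriword⁻ t) eq
... | v , zv , v≼w , eq′ = 0F ∷ v , 0∷-isTriword zv , 0∷ ≼⇒⊆₂ v≼w , eq′
-- The tail has no 2 left to give up, so the leading 1 has to go; `𝟎` lies below everything.
⊴-lower {n} {zero}  {w = 1F ∷ w} t eq =
  _ , isTriword (𝟎 {suc n}) , 0∷ 0s-⊆₂ , twos-0s n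
⊴-lower {m = suc m} {w = 1F ∷ w} t eq with oneTail-lower (1∷-isTriword⁻ t) (ℕ.suc-injective eq)
... | v , ov , v≼w , eq′ = 1F ∷ v , 1∷-isTriword ov , 1∷ v≼w , cong suc eq′
⊴-lower {w = 2F ∷ w} t eq = contradiction t 2∷-¬isTriword

height≡0 : {w : Word (suc n)} → IsTriword w → height w ≡ 0 → w ≡ replicate (suc n) 0F
height≡0 {w = 0F ∷ w} t eq = cong (0F ∷_) (zeroTail-0s (0∷-isTriword⁻ t) eq)
height≡0 {w = 2F ∷ w} t eq = contradiction t 2∷-¬isTriword

length-filter-map-suc : ∀ a (w : Word n) is →
  length (filter (λ i → lookup (a ∷ w) i Fin.≟ 2F) (List.map suc is)) ≡
  length (filter (λ i → lookup w i Fin.≟ 2F) is)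
length-filter-map-suc a w [] = refl
length-filter-map-suc a w (i ∷ is) with lookup w i Fin.≟ 2F
... | yes _ = cong suc (length-filter-map-suc a w is)
... | no  _ = length-filter-map-suc a w is

count-twos : (w : Word n) → length (filter (λ i → lookup w i Fin.≟ 2F) (allFin n)) ≡ twos w
count-twos [] = refl
count-twos {suc n} (a ∷ w) = by-head a
  where
  tail≡ : ∀ a → length (filter (λ i → lookup (a ∷ w) i Fin.≟ 2F) (List.tabulate suc)) ≡ twos w
  tail≡ a = trans
    (cong (λ is → length (filter (λ i → lookup (a ∷ w) i Fin.≟ 2F) is))
      (sym (List.map-tabulate {n = n} id suc)))
    (trans (length-filter-map-suc a w (allFin n)) (count-twos w))
  by-head : ∀ a →
    length (filter (λ i → lookup (a ∷ w) i Fin.≟ 2F) (allFin (suc n))) ≡ twos (a ∷ w)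
  by-head 0F = tail≡ 0F
  by-head 1F = tail≡ 1F
  by-head 2F = cong suc (tail≡ 2F)

[no-1]≡1 : (w : Word n) → (∀ k → lookup w k ≢ 1F) → [no-1] w ≡ 1
[no-1]≡1 []       _  = refl
[no-1]≡1 (0F ∷ w) ≢1 = [no-1]≡1 w (≢1 ∘ suc)
[no-1]≡1 (1F ∷ w) ≢1 = contradiction refl (≢1 zero)
[no-1]≡1 (2F ∷ w) ≢1 = [no-1]≡1 w (≢1 ∘ suc)

[no-1]≡0 : (w : Word n) → ∀ k → lookup w k ≡ 1F → [no-1] w ≡ 0
[no-1]≡0 (1F ∷ w) _       _  = refl
[no-1]≡0 (0F ∷ w) (suc k) eq = [no-1]≡0 w k eq
[no-1]≡0 (2F ∷ w) (suc k) eq = [no-1]≡0 w k eq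

atomicity : Word (suc n) → ℕ
atomicity (0F ∷ w) = twos w
atomicity (1F ∷ w) = [no-1] w ℕ.+ twos w
atomicity (2F ∷ w) = twos w

-- Transfer to `Hoch` and the rank function.

module _ (N : ℕ) where
  open FiniteLattice (Hoch (suc N)) using (_⊑_; ∣Can∣; neg)

  private
    fromEntries : (f : Fin (suc N) → Fin 3) → f zero ≢ 2F →
                  (∀ {i j} → i < j → f i ≡ 0F → f j ≢ 1F) →
                  ∃ λ (u : Tri (suc N)) → ∀ i → lookup (value u) i ≡ f i
    fromEntries f f₀≢2 f-01 = (tabulate f , [ t₂ , t₃ ]) , Vec.lookup∘tabulate f
      where
      t₂ : ∀ i → toℕ i ≡ 0 → lookup (tabulate f) i ≢ 2F
      t₂ zero _ = f₀≢2
      t₃ : ∀ i → lookup (tabulate f) i ≡ 0F → ∀ j → i < j → lookup (tabulate f) j ≢ 1F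
      t₃ i fᵢ≡0 j i<j fⱼ≡1 = f-01 i<j (trans (sym (Vec.lookup∘tabulate f i)) fᵢ≡0)
                                      (trans (sym (Vec.lookup∘tabulate f j)) fⱼ≡1)

    coordinates : Coordinates (Hoch (suc N)) N
    coordinates = record
      { _!_         = λ u → lookup (value u)
      ; ≤⇒!≤        = Pointwise.lookup
      ; !≤⇒≤        = pointwise
      ; ∨-sel       = λ u v → zipWith-sel _⊔_ ⊔-sel (value u) (value v)
      ; ⊥-!         = λ i → Vec.lookup-replicate i 0F
      ; first≢2     = λ u → proj₁ (isTriword u) zero refl
      ; 0-before⇒≢1 = λ u i<j uᵢ≡0 → proj₂ (isTriword u) _ uᵢ≡0 _ i<j
      ; fromEntries = fromEntries
      }

  open Labels coordinates

  ⊑⇒⊴ : (u v : Tri (suc N)) → u ⊑ v → value u ⊴ value v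
  ⊑⇒⊴ u@(_ ∷ _ , _) v@(_ ∷ _ , _) u⊑v with ⊑⇒Subordinate {u} {v} (λ {c} → u⊑v {c})
  ... | inj₁ (refl , 2⇒2) = 0∷ extensional⇒inductive (ext 2⇒2)
  ... | inj₂ (refl , refl , entries) = 1∷ extensional⇒inductive (ext (entries ∘ suc))

  ⊴⇒⊑ : (u v : Tri (suc N)) → value u ⊴ value v → u ⊑ v
  ⊴⇒⊑ u@(_ ∷ _ , _) v@(_ ∷ _ , _) u⊴v {c} = Subordinate⇒⊑ {u} {v} (sub u⊴v) {c}
    where
    sub : value u ⊴ value v → Subordinate u v
    sub (0∷ s) = inj₁ (refl , λ i → Pointwise.lookup s i)
    sub (1∷ s) = inj₂ (refl , refl , λ { zero → inj₂ refl ; (suc i) → Pointwise.lookup s i })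

  ∣Can∣≡height : (u : Tri (suc N)) → ∣Can∣ u ≡ height (value u)
  ∣Can∣≡height u@(0F ∷ w , _) = trans (∣Can∣-zero refl) (count-twos w)
  ∣Can∣≡height u@(1F ∷ w , _) =
    trans (∣Can∣-one (proj₂ (lastOne {u} λ ()))) (cong suc (count-twos w))
  ∣Can∣≡height u@(2F ∷ w , _) = contradiction (isTriword u) 2∷-¬isTriword

  neg≡atomicity : (u : Tri (suc N)) → neg u ≡ atomicity (value u)
  neg≡atomicity u@(0F ∷ w , _) =
    trans (neg-otherwise λ last → contradiction (IsLastOne.here≡1 last) λ ()) (count-twos w)
  neg≡atomicity u@(1F ∷ w , _) = by-cases (Fin.any? λ k → lookup w k Fin.≟ 1F)
    where
    by-cases : Dec (∃ λ k → lookup w k ≡ 1F) → neg u ≡ [no-1] w ℕ.+ twos w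
    by-cases (yes (k , wₖ≡1)) = trans
      (neg-otherwise λ last → IsLastOne.after≢1 last {suc k} (s≤s z≤n) wₖ≡1)
      (trans (count-twos w) (cong (ℕ._+ twos w) (sym ([no-1]≡0 w k wₖ≡1))))
    by-cases (no none) = trans
      (neg-one (refl , λ { {zero} () ; {suc k} _ wₖ≡1 → none (k , wₖ≡1) }))
      (trans (cong suc (count-twos w))
        (cong (ℕ._+ twos w) (sym ([no-1]≡1 w λ k eq → none (k , eq)))))
  neg≡atomicity u@(2F ∷ w , _) = contradiction (isTriword u) 2∷-¬isTriword

  ⊑-refl : (u : Tri (suc N)) → u ⊑ u
  ⊑-refl u Ψ-c = Ψ-c

  ⊑-trans : (u v w : Tri (suc N)) → u ⊑ v → v ⊑ w → u ⊑ w
  ⊑-trans u v w u⊑v v⊑w {c} Ψ-c = v⊑w {c} (u⊑v {c} Ψ-c)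

  ⊑-strict : (u v : Tri (suc N)) → u ⊑ v → u ≡ v ⊎ height (value u) ℕ.< height (value v)
  ⊑-strict u v u⊑v = map₁ (value-injective {v = u} {w = v})
    (⊴-strict (isTriword u) (isTriword v) (⊑⇒⊴ u v λ {c} → u⊑v {c}))

  ⊑-antisym : (u v : Tri (suc N)) → u ⊑ v → v ⊑ u → u ≡ v
  ⊑-antisym u v u⊑v v⊑u with ⊑-strict u v (λ {c} → u⊑v {c}) | ⊑-strict v u (λ {c} → v⊑u {c})
  ... | inj₁ eq | _       = eq
  ... | inj₂ _  | inj₁ eq = sym eq
  ... | inj₂ lt | inj₂ gt = contradiction gt (ℕ.<-asym lt)

  -- Induction on the height. `⊴-lower` gives some v below u with height one less; as heights
  -- increase strictly along `⊑`, nothing fits in between. So u covers v and `rk` rises by one.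
  rank≡height : (rk : Tri (suc N) → ℕ) → IsRankFunction _⊑_ 𝟎 rk →
                ∀ u → rk u ≡ height (value u)
  rank≡height rk (rk-𝟎 , rk-⋖) u = go _ u refl
    where
    go : ∀ h u → height (value u) ≡ h → rk u ≡ h
    go zero    u eq =
      trans (cong rk (value-injective {v = u} {w = 𝟎} (height≡0 (isTriword u) eq))) rk-𝟎
    go (suc h) u eq =
      let e , t , e⊴u , eq′ = ⊴-lower (isTriword u) eq
          v = e , [ t ]
          between : ∀ c → ¬ ((v ⊑ c × v ≢ c) × (c ⊑ u × c ≢ u))
          between c ((v⊑c , v≢c) , (c⊑u , c≢u)) =
            ℕ.<⇒≱ ([ (λ e → contradiction e c≢u) , id ]′ (⊑-strict c u λ {d} → c⊑u {d}))
              (subst (ℕ._≤ height (value c)) (trans (cong suc eq′) (sym eq))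
                ([ (λ e → contradiction e v≢c) , id ]′ (⊑-strict v c λ {d} → v⊑c {d})))
          v≢u : v ≢ u
          v≢u v≡u = ℕ.1+n≢n (trans (sym eq) (trans (cong (height ∘ value) (sym v≡u)) eq′))
      in trans (rk-⋖ v u (((λ {c} → ⊴⇒⊑ v u e⊴u {c}) , v≢u) , between))
               (cong suc (go h v eq′))

-- Finite sums and Möbius inversion

module Sums {c ℓ} (R : CommutativeRing c ℓ) where
  open CommutativeRing R hiding (zero) renaming
    (refl to ≈-refl; sym to ≈-sym; trans to ≈-trans; reflexive to ≈-reflexive)
  open Triangles R
  open import Algebra.Properties.CommutativeSemigroup +-commutativeSemigroup
    using () renaming (interchange to +-interchange)
  open import Algebra.Properties.Ring ring using (-‿distribˡ-*; -0#≈0#; -‿+-comm)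
  open import Algebra.Properties.Monoid.Mult +-monoid using (×-homo-+) renaming (_×_ to _ℕ×_)
  open import Relation.Binary.Reasoning.Setoid setoid
  open Solver commutativeSemiring using (solve; _:=_; _:+_; _:*_; con)

  private
    variable
      A : Set
      B : Set
      P Q : Set

  -- Only `does` matters, so for concrete heads the indicator of a relation on `a ∷ v` and `b ∷ w`
  -- computes to that of the tails or to `0#`. The recursions over words below rely on this.
  χ : Dec P → Carrier
  χ P? = if does P? then 1# else 0#

  χ-true : (P? : Dec P) → P → χ P? ≈ 1#
  χ-true (yes _) _ = ≈-refl
  χ-true (no ¬p) p = contradiction p ¬p

  χ-false : (P? : Dec P) → ¬ P → χ P? ≈ 0#
  χ-false (yes p) ¬p = contradiction p ¬p
  χ-false (no _)  _  = ≈-refl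

  χ-cong : (P? : Dec P) (Q? : Dec Q) → (P → Q) → (Q → P) → χ P? ≈ χ Q?
  χ-cong P? Q? P⇒Q Q⇒P =
    ≈-reflexive (cong (if_then 1# else 0#) (does-⇔ (mk⇔ P⇒Q Q⇒P) P? Q?))

  ∑ : List A → (A → Carrier) → Carrier
  ∑ xs f = foldr _+_ 0# (map f xs)

  ∑-cong : ∀ xs {f g : A → Carrier} → (∀ x → f x ≈ g x) → ∑ xs f ≈ ∑ xs g
  ∑-cong []       f≈g = ≈-refl
  ∑-cong (x ∷ xs) f≈g = +-cong (f≈g x) (∑-cong xs f≈g)

  ∑-0 : ∀ (xs : List A) → ∑ xs (λ _ → 0#) ≈ 0#
  ∑-0 []       = ≈-refl
  ∑-0 (x ∷ xs) = ≈-trans (+-identityˡ _) (∑-0 xs)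

  ∑-+ : ∀ xs (f g : A → Carrier) → ∑ xs (λ x → f x + g x) ≈ ∑ xs f + ∑ xs g
  ∑-+ []       f g = ≈-sym (+-identityˡ 0#)
  ∑-+ (x ∷ xs) f g = ≈-trans (+-congˡ (∑-+ xs f g))
    (+-interchange _ _ _ _)

  ∑-*ˡ : ∀ xs a (f : A → Carrier) → ∑ xs (λ x → a * f x) ≈ a * ∑ xs f
  ∑-*ˡ []       a f = ≈-sym (zeroʳ a)
  ∑-*ˡ (x ∷ xs) a f = ≈-trans (+-congˡ (∑-*ˡ xs a f)) (≈-sym (distribˡ a _ _))

  ∑-*ʳ : ∀ xs a (f : A → Carrier) → ∑ xs (λ x → f x * a) ≈ ∑ xs f * a
  ∑-*ʳ []       a f = ≈-sym (zeroˡ a)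
  ∑-*ʳ (x ∷ xs) a f = ≈-trans (+-congˡ (∑-*ʳ xs a f)) (≈-sym (distribʳ a _ _))

  ∑-swap : ∀ xs ys (f : A → B → Carrier) →
           ∑ xs (λ x → ∑ ys (f x)) ≈ ∑ ys (λ y → ∑ xs (λ x → f x y))
  ∑-swap []       ys f = ≈-sym (∑-0 ys)
  ∑-swap (x ∷ xs) ys f = ≈-trans (+-congˡ (∑-swap xs ys f)) (≈-sym (∑-+ ys (f x) _))

  ∑-++ : ∀ xs ys (f : A → Carrier) → ∑ (xs ++ ys) f ≈ ∑ xs f + ∑ ys f
  ∑-++ []       ys f = ≈-sym (+-identityˡ _)
  ∑-++ (x ∷ xs) ys f = ≈-trans (+-congˡ (∑-++ xs ys f)) (≈-sym (+-assoc _ _ _))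

  ∑-map : ∀ (g : A → B) xs (f : B → Carrier) → ∑ (map g xs) f ≈ ∑ xs (f ∘ g)
  ∑-map g []       f = ≈-refl
  ∑-map g (x ∷ xs) f = +-congˡ (∑-map g xs f)

  ∑-filter : {P : Pred A 0ℓ} (P? : Unary.Decidable P) → ∀ xs (f : A → Carrier) →
             ∑ (filter P? xs) f ≈ ∑ xs (λ x → χ (P? x) * f x)
  ∑-filter P? []       f = ≈-refl
  ∑-filter P? (x ∷ xs) f with P? x
  ... | yes _ = +-cong (≈-sym (*-identityˡ _)) (∑-filter P? xs f)
  ... | no  _ = ≈-trans (∑-filter P? xs f) (≈-trans (≈-sym (+-identityˡ _))
    (+-congʳ (≈-sym (zeroˡ _))))

  ∑-χ : (_≟_ : DecidableEquality A) → ∀ {a xs} → Unique xs → a ∈ xs → (f : A → Carrier) →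
        ∑ xs (λ x → χ (a ≟ x) * f x) ≈ f a
  ∑-χ _≟_ {a} (a≢xs ∷ _) (here refl) f =
    ≈-trans (+-cong (≈-trans (*-congʳ (χ-true (a ≟ a) refl)) (*-identityˡ _)) (none a≢xs))
            (+-identityʳ _)
    where
    none : ∀ {xs} → All (a ≢_) xs → ∑ xs (λ x → χ (a ≟ x) * f x) ≈ 0#
    none []                 = ≈-refl
    none (_∷_ {x} a≢x a≢xs) =
      ≈-trans (+-cong (≈-trans (*-congʳ (χ-false (a ≟ x) a≢x)) (zeroˡ _)) (none a≢xs))
              (+-identityˡ _)
  ∑-χ _≟_ {a} (_∷_ {x} x≢xs !xs) (there a∈) f =
    ≈-trans (+-cong (≈-trans (*-congʳ (χ-false (a ≟ x) λ eq → All.lookup x≢xs a∈ (sym eq))) (zeroˡ _))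
                    (∑-χ _≟_ !xs a∈ f))
            (+-identityˡ _)

  ⟦_⟧ : ℤ → Carrier
  ⟦ i ⟧ = i · 1#

  private
    ℕ×≈ : ∀ n a → n ℕ× a ≈ (n ℕ× 1#) * a
    ℕ×≈ zero    a = ≈-sym (zeroˡ a)
    ℕ×≈ (suc n) a = ≈-trans (+-cong (≈-sym (*-identityˡ a)) (ℕ×≈ n a)) (≈-sym (distribʳ a _ _))

  ·≈⟦⟧* : ∀ i a → i · a ≈ ⟦ i ⟧ * a
  ·≈⟦⟧* (+ n)      a = ℕ×≈ n a
  ·≈⟦⟧* (-[1+ n ]) a = ≈-trans (-‿cong (ℕ×≈ (suc n) a)) (-‿distribˡ-* _ a)

  private
    ⟦⊖⟧ : ∀ m n → ⟦ m ⊖ n ⟧ ≈ m ℕ× 1# - n ℕ× 1#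
    ⟦⊖⟧ zero    zero    = ≈-sym (-‿inverseʳ 0#)
    ⟦⊖⟧ zero    (suc n) = ≈-sym (+-identityˡ _)
    ⟦⊖⟧ (suc m) zero    = ≈-sym (≈-trans (+-congˡ -0#≈0#) (+-identityʳ _))
    ⟦⊖⟧ (suc m) (suc n) = begin
      ⟦ suc m ⊖ suc n ⟧                ≡⟨ cong ⟦_⟧ (ℤ.[1+m]⊖[1+n]≡m⊖n m n) ⟩
      ⟦ m ⊖ n ⟧                        ≈⟨ ⟦⊖⟧ m n ⟩
      m₁ - n₁                          ≈⟨ +-identityˡ _ ⟨
      0# + (m₁ - n₁)                   ≈⟨ +-congʳ (-‿inverseʳ 1#) ⟨
      (1# - 1#) + (m₁ - n₁)            ≈⟨ +-interchange _ _ _ _ ⟩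
      (1# + m₁) + (- 1# - n₁)          ≈⟨ +-congˡ (-‿+-comm 1# n₁) ⟩
      (1# + m₁) - (1# + n₁)            ∎
      where
      m₁ = m ℕ× 1#
      n₁ = n ℕ× 1#

  ⟦⟧-+ : ∀ i j → ⟦ i ℤ.+ j ⟧ ≈ ⟦ i ⟧ + ⟦ j ⟧
  ⟦⟧-+ (+ m)      (+ n)      = ×-homo-+ 1# m n
  ⟦⟧-+ (+ m)      (-[1+ n ]) = ⟦⊖⟧ m (suc n)
  ⟦⟧-+ (-[1+ m ]) (+ n)      = ≈-trans (⟦⊖⟧ n (suc m)) (+-comm _ _)
  ⟦⟧-+ (-[1+ m ]) (-[1+ n ]) = begin
    - (suc (suc (m ℕ.+ n)) ℕ× 1#)      ≡⟨ cong (λ k → - (k ℕ× 1#)) (sym (ℕ.+-suc (suc m) n)) ⟩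
    - ((suc m ℕ.+ suc n) ℕ× 1#)        ≈⟨ -‿cong (×-homo-+ 1# (suc m) (suc n)) ⟩
    - (suc m ℕ× 1# + suc n ℕ× 1#)      ≈⟨ -‿+-comm _ _ ⟨
    - (suc m ℕ× 1#) - (suc n ℕ× 1#)    ∎

  ⟦⟧-∑ : ∀ xs (f : A → ℤ) → ⟦ foldr ℤ._+_ 0ℤ (map f xs) ⟧ ≈ ∑ xs (λ x → ⟦ f x ⟧)
  ⟦⟧-∑ []       f = ≈-refl
  ⟦⟧-∑ (x ∷ xs) f = ≈-trans (⟦⟧-+ (f x) _) (+-congˡ (⟦⟧-∑ xs f))

  module MöbiusInversion (L : FiniteLattice)
    {_≼_ : Rel (FiniteLattice.Carrier L) 0ℓ} (_≼?_ : Decidable _≼_)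
    (≼-refl : ∀ a → a ≼ a)
    (≼-trans : ∀ a b c → a ≼ b → b ≼ c → a ≼ c)
    (≼-antisym : ∀ a b → a ≼ b → b ≼ a → a ≡ b)
    (μ : FiniteLattice.Carrier L → FiniteLattice.Carrier L → ℤ)
    (isMöbius : FiniteLattice.IsMöbiusFunction L _≼?_ μ)
    where

    open FiniteLattice L using (_≟_; elements; complete; unique) renaming (Carrier to E)

    private
      μ-diag = proj₁ isMöbius
      μ-sum  = proj₁ (proj₂ isMöbius)
      μ-out  = proj₂ (proj₂ isMöbius)

    μ*ζ≈δ : ∀ a b → ∑ elements (λ c → ⟦ μ a c ⟧ * χ (c ≼? b)) ≈ χ (a ≟ b)
    μ*ζ≈δ a b with a ≟ b
    ... | yes refl = ≈-trans (∑-cong elements diag) (∑-χ _≟_ unique (complete a) (λ _ → 1#))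
      where
      diag : ∀ c → ⟦ μ a c ⟧ * χ (c ≼? a) ≈ χ (a ≟ c) * 1#
      diag c with a ≟ c | a ≼? c
      ... | yes refl | _ = begin
        ⟦ μ a a ⟧ * χ (a ≼? a) ≈⟨ *-cong (≈-reflexive (cong ⟦_⟧ (μ-diag a)))
                                         (χ-true (a ≼? a) (≼-refl a)) ⟩
        (1# + 0#) * 1#         ≈⟨ *-congʳ (+-identityʳ 1#) ⟩
        1# * 1#                ∎
      ... | no a≢c | yes a≼c = begin
        ⟦ μ a c ⟧ * χ (c ≼? a) ≈⟨ *-congˡ (χ-false (c ≼? a) (a≢c ∘ ≼-antisym a c a≼c)) ⟩
        ⟦ μ a c ⟧ * 0#         ≈⟨ ≈-trans (zeroʳ _) (≈-sym (zeroˡ 1#)) ⟩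
        0# * 1#                ∎
      ... | no _ | no a⋠c = *-cong-0 (≈-reflexive (cong ⟦_⟧ (μ-out a c a⋠c)))
        where
        *-cong-0 : ∀ {x y} → x ≈ 0# → x * y ≈ 0# * 1#
        *-cong-0 x≈0 = ≈-trans (*-congʳ x≈0) (≈-trans (zeroˡ _) (≈-sym (zeroˡ 1#)))
    ... | no a≢b with a ≼? b
    ...   | yes a≼b = begin
      ∑ elements (λ c → ⟦ μ a c ⟧ * χ (c ≼? b))                   ≈⟨ ∑-cong elements within ⟩
      ∑ elements (λ c → χ (between? c) * ⟦ μ a c ⟧)               ≈⟨ ∑-filter between? elements _ ⟨
      ∑ (filter between? elements) (λ c → ⟦ μ a c ⟧)              ≈⟨ ⟦⟧-∑ (filter between? elements) (μ a) ⟨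
      ⟦ foldr ℤ._+_ 0ℤ (map (μ a) (filter between? elements)) ⟧   ≡⟨ cong ⟦_⟧ (μ-sum a b a≼b a≢b) ⟩
      0# ∎
      where
      between? : Unary.Decidable λ c → (a ≼ c) × (c ≼ b)
      between? c = (a ≼? c) ×-dec (c ≼? b)

      within : ∀ c → ⟦ μ a c ⟧ * χ (c ≼? b) ≈ χ (between? c) * ⟦ μ a c ⟧
      within c with a ≼? c
      ... | yes _   = *-comm _ _
      ... | no a⋠c = begin
        ⟦ μ a c ⟧ * χ (c ≼? b) ≡⟨ cong (λ i → ⟦ i ⟧ * χ (c ≼? b)) (μ-out a c a⋠c) ⟩
        0# * χ (c ≼? b)        ≈⟨ ≈-trans (zeroˡ _) (≈-sym (zeroˡ _)) ⟩
        0# * ⟦ μ a c ⟧         ∎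
    ...   | no a⋠b = ≈-trans (∑-cong elements vanish) (∑-0 elements)
      where
      vanish : ∀ c → ⟦ μ a c ⟧ * χ (c ≼? b) ≈ 0#
      vanish c with a ≼? c
      ... | yes a≼c = ≈-trans (*-congˡ (χ-false (c ≼? b) (a⋠b ∘ ≼-trans a c b a≼c))) (zeroʳ _)
      ... | no  a⋠c = ≈-trans (*-congʳ (≈-reflexive (cong ⟦_⟧ (μ-out a c a⋠c)))) (zeroˡ _)

    -- F = ζ K implies μ F = K. The factor x is carried along because in the M-triangle the power
    -- with exponent `rk u` stands inside the sum over v.
    inversion : {F K : E → Carrier} → (∀ a → F a ≈ ∑ elements (λ b → χ (a ≼? b) * K b)) →
                ∀ a x → ∑ elements (λ b → μ a b · (x * F b)) ≈ x * K a
    inversion {F} {K} F≈∑K a x = begin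
      ∑ elements (λ b → μ a b · (x * F b))
        ≈⟨ ∑-cong elements (λ b → ≈-trans (·≈⟦⟧* (μ a b) _) (expand b)) ⟩
      ∑ elements (λ b → ∑ elements (λ c → x * ((⟦ μ a b ⟧ * χ (b ≼? c)) * K c)))
        ≈⟨ ∑-swap elements elements _ ⟩
      ∑ elements (λ c → ∑ elements (λ b → x * ((⟦ μ a b ⟧ * χ (b ≼? c)) * K c)))
        ≈⟨ ∑-cong elements (λ c → ≈-trans (∑-*ˡ elements x _) (*-congˡ
             (≈-trans (∑-*ʳ elements (K c) _) (*-congʳ (μ*ζ≈δ a c))))) ⟩
      ∑ elements (λ c → x * (χ (a ≟ c) * K c))
        ≈⟨ ∑-*ˡ elements x _ ⟩
      x * ∑ elements (λ c → χ (a ≟ c) * K c)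
        ≈⟨ *-congˡ (∑-χ _≟_ unique (complete a) K) ⟩
      x * K a ∎
      where
      expand : ∀ b → ⟦ μ a b ⟧ * (x * F b) ≈
                     ∑ elements (λ c → x * ((⟦ μ a b ⟧ * χ (b ≼? c)) * K c))
      expand b = begin
        ⟦ μ a b ⟧ * (x * F b)
          ≈⟨ *-congˡ (*-congˡ (F≈∑K b)) ⟩
        ⟦ μ a b ⟧ * (x * ∑ elements (λ c → χ (b ≼? c) * K c))
          ≈⟨ *-assoc _ _ _ ⟨
        (⟦ μ a b ⟧ * x) * ∑ elements (λ c → χ (b ≼? c) * K c)
          ≈⟨ ∑-*ˡ elements _ _ ⟨
        ∑ elements (λ c → (⟦ μ a b ⟧ * x) * (χ (b ≼? c) * K c))
          ≈⟨ ∑-cong elements (λ c →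
               solve 4 (λ m x k l → (m :* x) :* (k :* l) := x :* ((m :* k) :* l)) ≈-refl _ _ _ _) ⟩
        ∑ elements (λ c → x * ((⟦ μ a b ⟧ * χ (b ≼? c)) * K c)) ∎

-- Sums over triwords

infix 4 _⊆₂?_ _≼?_ _⊴?_

_⊆₂?_ : Decidable (_⊆₂_ {n})
_⊆₂?_ = Pointwise.decidable λ a b → (a Fin.≟ 2F) →-dec (b Fin.≟ 2F)

_≼?_ : Decidable (_≼_ {n})
_≼?_ = Pointwise.decidable λ a b → (b Fin.≟ 2F) ⊎-dec (a Fin.≟ b)

_⊴?_ : Decidable (_⊴_ {n})
(0F ∷ v) ⊴? (_ ∷ w)  = map′ 0∷_ (λ { (0∷ s) → s }) (v ⊆₂? w)
(1F ∷ v) ⊴? (1F ∷ w) = map′ 1∷_ (λ { (1∷ s) → s }) (v ≼? w)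
(1F ∷ v) ⊴? (0F ∷ w) = no λ ()
(1F ∷ v) ⊴? (2F ∷ w) = no λ ()
(2F ∷ v) ⊴? (_ ∷ w)  = no λ ()

⊆₂-trans : {u v w : Word n} → u ⊆₂ v → v ⊆₂ w → u ⊆₂ w
⊆₂-trans = Pointwise.trans λ f g eq → g (f eq)

twos+others : (w : Word n) → twos w ℕ.+ others w ≡ n
twos+others []       = refl
twos+others (0F ∷ w) = trans (ℕ.+-suc (twos w) _) (cong suc (twos+others w))
twos+others (1F ∷ w) = trans (ℕ.+-suc (twos w) _) (cong suc (twos+others w))
twos+others (2F ∷ w) = cong suc (twos+others w)

twos-cong : v ⊆₂ w → w ⊆₂ v → twos v ≡ twos w
twos-cong v⊆w w⊆v = ℕ.≤-antisym (twos-mono v⊆w) (twos-mono w⊆v)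

others-cong : v ⊆₂ w → w ⊆₂ v → others v ≡ others w
others-cong {v = v} {w} v⊆w w⊆v = ℕ.+-cancelˡ-≡ (twos v) _ _ (trans (twos+others v)
  (sym (trans (cong (ℕ._+ others w) (twos-cong v⊆w w⊆v)) (twos+others w))))

[no-1]-zeroTail : ZeroTail w → [no-1] w ≡ 1
[no-1]-zeroTail {w = w} z = [no-1]≡1 w (zeroTail⁻ z)

module WordSums {c ℓ} (R : CommutativeRing c ℓ) where
  open CommutativeRing R hiding (zero) renaming
    (refl to ≈-refl; sym to ≈-sym; trans to ≈-trans; reflexive to ≈-reflexive)
  open Triangles R
  open Sums R
  open import Algebra.Properties.CommutativeSemigroup +-commutativeSemigroup
    using () renaming (interchange to +-interchange)
  open import Algebra.Properties.CommutativeSemigroup *-commutativeSemigroup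
    using () renaming (interchange to *-interchange)
  open import Algebra.Properties.Monoid.Mult +-monoid using () renaming (_×_ to _ℕ×_)
  open import Algebra.Properties.CommutativeSemiring.Exp commutativeSemiring
    using (^-distrib-*; ^-homo-*)
  open import Relation.Binary.Reasoning.Setoid setoid
  open Solver commutativeSemiring using (solve; _:=_; _:+_; _:*_; con)

  -- Sums over zero tails and over one tails. They recurse like `ZeroTail` and `OneTail`, so that
  -- identities can be proved entry by entry.
  ΣZ ΣO : ∀ n → (Word n → Carrier) → Carrier
  ΣZ zero    f = f []
  ΣZ (suc n) f = ΣZ n (f ∘ (0F ∷_)) + ΣZ n (f ∘ (2F ∷_))
  ΣO zero    f = f []
  ΣO (suc n) f = ΣZ n (f ∘ (0F ∷_)) + (ΣO n (f ∘ (1F ∷_)) + ΣO n (f ∘ (2F ∷_)))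

  ΣZ-cong : ∀ n {f g} → (∀ {w} → ZeroTail w → f w ≈ g w) → ΣZ n f ≈ ΣZ n g
  ΣZ-cong zero    f≈g = f≈g []
  ΣZ-cong (suc n) f≈g = +-cong (ΣZ-cong n (f≈g ∘ 0∷_)) (ΣZ-cong n (f≈g ∘ 2∷_))

  ΣO-cong : ∀ n {f g} → (∀ {w} → OneTail w → f w ≈ g w) → ΣO n f ≈ ΣO n g
  ΣO-cong zero    f≈g = f≈g []
  ΣO-cong (suc n) f≈g = +-cong (ΣZ-cong n (f≈g ∘ 0∷_))
    (+-cong (ΣO-cong n (f≈g ∘ 1∷_)) (ΣO-cong n (f≈g ∘ 2∷_)))

  ΣZ-*ˡ : ∀ n a f → ΣZ n (λ w → a * f w) ≈ a * ΣZ n f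
  ΣZ-*ˡ zero    a f = ≈-refl
  ΣZ-*ˡ (suc n) a f = ≈-trans (+-cong (ΣZ-*ˡ n a _) (ΣZ-*ˡ n a _)) (≈-sym (distribˡ a _ _))

  ΣO-*ˡ : ∀ n a f → ΣO n (λ w → a * f w) ≈ a * ΣO n f
  ΣO-*ˡ zero    a f = ≈-refl
  ΣO-*ˡ (suc n) a f = ≈-trans
    (+-cong (ΣZ-*ˡ n a _) (≈-trans (+-cong (ΣO-*ˡ n a _) (ΣO-*ˡ n a _)) (≈-sym (distribˡ a _ _))))
    (≈-sym (distribˡ a _ _))

  ΣZ-+ : ∀ n f g → ΣZ n (λ w → f w + g w) ≈ ΣZ n f + ΣZ n g
  ΣZ-+ zero    f g = ≈-refl
  ΣZ-+ (suc n) f g = ≈-trans (+-cong (ΣZ-+ n _ _) (ΣZ-+ n _ _))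
    (+-interchange _ _ _ _)

  ΣZ-0*  : ∀ n f → ΣZ n (λ w → 0# * f w) ≈ 0#
  ΣZ-0* n f = ≈-trans (ΣZ-*ˡ n 0# f) (zeroˡ _)

  ΣO-0*  : ∀ n f → ΣO n (λ w → 0# * f w) ≈ 0#
  ΣO-0* n f = ≈-trans (ΣO-*ˡ n 0# f) (zeroˡ _)

  private
    ∑-words : ∀ n (f : Word (suc n) → Carrier) →
      ∑ (words (suc n)) f ≈
      ∑ (words n) (f ∘ (0F ∷_)) + (∑ (words n) (f ∘ (1F ∷_)) + ∑ (words n) (f ∘ (2F ∷_)))
    ∑-words n f =
      ≈-trans (∑-++ (map (0F ∷_) (words n)) _ f) (+-cong (∑-map _ (words n) f)
      (≈-trans (∑-++ (map (1F ∷_) (words n)) _ f) (+-cong (∑-map _ (words n) f)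
      (≈-trans (∑-++ (map (2F ∷_) (words n)) _ f) (≈-trans (+-congʳ (∑-map _ (words n) f))
      (+-identityʳ _))))))

    ∑-none : {P : Pred (Word n) 0ℓ} (P? : Unary.Decidable P) → (∀ {w} → ¬ P w) →
             ∀ (f : Word n → Carrier) → ∑ (words n) (λ w → χ (P? w) * f w) ≈ 0#
    ∑-none {n} P? ¬P f =
      ≈-trans (∑-cong (words n) λ w → ≈-trans (*-congʳ (χ-false (P? w) ¬P)) (zeroˡ _))
              (∑-0 (words n))

    χ-[] : {P : Set} (P? : Dec P) → P → ∀ a → χ P? * a + 0# ≈ a
    χ-[] P? p a = ≈-trans (+-identityʳ _) (≈-trans (*-congʳ (χ-true P? p)) (*-identityˡ a))

  -- P is kept abstract because the recursion passes to `P? ∘ (a ∷_)`, which is no longer the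
  -- triword test with a single letter in front.
  ∑-zeroTails : {P : Pred (Word n) 0ℓ} (P? : Unary.Decidable P) →
                (∀ {w} → P w → ZeroTail w) → (∀ {w} → ZeroTail w → P w) →
                ∀ f → ∑ (words n) (λ w → χ (P? w) * f w) ≈ ΣZ n f
  ∑-zeroTails {zero}  P? P⇒Z Z⇒P f = χ-[] (P? []) (Z⇒P []) (f [])
  ∑-zeroTails {suc n} P? P⇒Z Z⇒P f = ≈-trans (∑-words n _) (+-cong
    (∑-zeroTails (P? ∘ (0F ∷_)) (λ p → case-0 (P⇒Z p)) (Z⇒P ∘ 0∷_) _)
    (≈-trans (+-cong (∑-none (P? ∘ (1F ∷_)) (λ p → case-1 (P⇒Z p)) (f ∘ (1F ∷_)))
                   (∑-zeroTails (P? ∘ (2F ∷_)) (λ p → case-2 (P⇒Z p)) (Z⇒P ∘ 2∷_) _))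
           (+-identityˡ _)))
    where
    case-0 : {w : Word n} → ZeroTail (0F ∷ w) → ZeroTail w
    case-0 (0∷ z) = z
    case-1 : {w : Word n} → ¬ ZeroTail (1F ∷ w)
    case-1 ()
    case-2 : {w : Word n} → ZeroTail (2F ∷ w) → ZeroTail w
    case-2 (2∷ z) = z

  ∑-oneTails : {P : Pred (Word n) 0ℓ} (P? : Unary.Decidable P) →
               (∀ {w} → P w → OneTail w) → (∀ {w} → OneTail w → P w) →
               ∀ f → ∑ (words n) (λ w → χ (P? w) * f w) ≈ ΣO n f
  ∑-oneTails {zero}  P? P⇒O O⇒P f = χ-[] (P? []) (O⇒P []) (f [])
  ∑-oneTails {suc n} P? P⇒O O⇒P f = ≈-trans (∑-words n _) (+-cong
    (∑-zeroTails (P? ∘ (0F ∷_)) (λ p → case-0 (P⇒O p)) (O⇒P ∘ 0∷_) _)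
    (+-cong (∑-oneTails (P? ∘ (1F ∷_)) (λ p → case-1 (P⇒O p)) (O⇒P ∘ 1∷_) _)
            (∑-oneTails (P? ∘ (2F ∷_)) (λ p → case-2 (P⇒O p)) (O⇒P ∘ 2∷_) _)))
    where
    case-0 : {w : Word n} → OneTail (0F ∷ w) → ZeroTail w
    case-0 (0∷ z) = z
    case-1 : {w : Word n} → OneTail (1F ∷ w) → OneTail w
    case-1 (1∷ o) = o
    case-2 : {w : Word n} → OneTail (2F ∷ w) → OneTail w
    case-2 (2∷ o) = o

  private
    ∑-mapMaybe-toTri : ∀ (us : List (Word n)) f →
                       ∑ (mapMaybe toTri us) (f ∘ value) ≈ ∑ us (λ u → χ (isTriword? u) * f u)
    ∑-mapMaybe-toTri []       f = ≈-refl
    ∑-mapMaybe-toTri (u ∷ us) f with isTriword? u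
    ... | yes p = +-cong (≈-sym (≈-trans (*-congʳ (χ-true (isTriword? u) p)) (*-identityˡ _)))
                         (∑-mapMaybe-toTri us f)
    ... | no ¬p = ≈-trans (∑-mapMaybe-toTri us f) (≈-trans (≈-sym (+-identityˡ _))
      (+-congʳ (≈-sym (≈-trans (*-congʳ (χ-false (isTriword? u) ¬p)) (zeroˡ _)))))

  Σ[Tri]-split : ∀ n f →
    Σ[Tri] (suc n) (f ∘ value) ≈ ΣZ n (f ∘ (0F ∷_)) + ΣO n (f ∘ (1F ∷_))
  Σ[Tri]-split n f = begin
    ∑ (mapMaybe toTri (words (suc n))) (f ∘ value)
      ≈⟨ ∑-mapMaybe-toTri (words (suc n)) f ⟩
    ∑ (words (suc n)) (λ u → χ (isTriword? u) * f u)
      ≈⟨ ∑-words n _ ⟩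
    _ ≈⟨ +-cong
           (∑-zeroTails {n} (λ w → isTriword? (0F ∷ w)) 0∷-isTriword⁻ 0∷-isTriword (f ∘ (0F ∷_)))
           (+-cong
             (∑-oneTails {n} (λ w → isTriword? (1F ∷ w)) 1∷-isTriword⁻ 1∷-isTriword (f ∘ (1F ∷_)))
             (∑-none {n} (λ w → isTriword? (2F ∷ w)) 2∷-¬isTriword (f ∘ (2F ∷_)))) ⟩
    ΣZ n (f ∘ (0F ∷_)) + (ΣO n (f ∘ (1F ∷_)) + 0#)
      ≈⟨ +-congˡ (+-identityʳ _) ⟩
    ΣZ n (f ∘ (0F ∷_)) + ΣO n (f ∘ (1F ∷_)) ∎

  TwosOnly : (Word n → Carrier) → Set ℓ
  TwosOnly f = ∀ {v w} → v ⊆₂ w → w ⊆₂ v → f v ≈ f w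

  private
    twosOnly-∷ : {f : Word (suc n) → Carrier} → TwosOnly f → ∀ a → TwosOnly (f ∘ (a ∷_))
    twosOnly-∷ f-twos a p q = f-twos (id ∷ p) (id ∷ q)

    twosOnly-1≈0 : {f : Word (suc n) → Carrier} → TwosOnly f → ∀ w → f (1F ∷ w) ≈ f (0F ∷ w)
    twosOnly-1≈0 f-twos w = f-twos ((λ ()) ∷ ⊆₂-refl) ((λ ()) ∷ ⊆₂-refl)

  ι : ℕ → Carrier
  ι k = k ℕ× 1#

  -- A triword 1 ∷ w is determined by its set of twos and by the number k ≥ 1 of its ones;
  -- k ranges over others w + 1 values, and k = 1 exactly when w contains no 1.
  ΣO-twosOnly : ∀ n {f} → TwosOnly f → ΣO n f ≈ ΣZ n (λ w → f w * ι (suc (others w)))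
  ΣO-twosOnly zero f-twos = ≈-sym (≈-trans (*-congˡ (+-identityʳ 1#)) (*-identityʳ _))
  ΣO-twosOnly (suc n) {f} f-twos = begin
    ΣZ n (f ∘ (0F ∷_)) + (ΣO n (f ∘ (1F ∷_)) + ΣO n (f ∘ (2F ∷_)))
      ≈⟨ +-congˡ (+-cong (≈-trans (ΣO-cong n λ {w} _ → twosOnly-1≈0 f-twos w)
                                  (ΣO-twosOnly n (twosOnly-∷ f-twos 0F)))
                         (ΣO-twosOnly n (twosOnly-∷ f-twos 2F))) ⟩
    ΣZ n (f ∘ (0F ∷_)) + (ΣZ n (λ w → f (0F ∷ w) * ι (suc (others w))) + _)
      ≈⟨ +-assoc _ _ _ ⟨
    (ΣZ n (f ∘ (0F ∷_)) + ΣZ n (λ w → f (0F ∷ w) * ι (suc (others w)))) + _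
      ≈⟨ +-congʳ (≈-trans (≈-sym (ΣZ-+ n _ _)) (ΣZ-cong n λ _ →
           ≈-trans (+-congʳ (≈-sym (*-identityʳ _))) (≈-sym (distribˡ _ _ _)))) ⟩
    ΣZ n (λ w → f (0F ∷ w) * ι (suc (suc (others w)))) + _ ∎

  -- For a given set of twos, the triword with k = 1 contributes y, and each of the remaining
  -- `others w` values of k contributes 1.
  ΣO-twosOnly-[no-1] : ∀ n {f} → TwosOnly f → ∀ y →
    ΣO n (λ w → f w * y ^ [no-1] w) ≈ ΣZ n (λ w → f w * (y + ι (others w)))
  ΣO-twosOnly-[no-1] zero f-twos y =
    *-congˡ (≈-trans (*-identityʳ y) (≈-sym (+-identityʳ y)))
  ΣO-twosOnly-[no-1] (suc n) {f} f-twos y = begin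
    ΣZ n (λ w → f (0F ∷ w) * y ^ [no-1] w) + (ΣO n (λ w → f (1F ∷ w) * 1#) + _)
      ≈⟨ +-cong
           (ΣZ-cong n λ {w} z → *-congˡ
             (≈-trans (≈-reflexive (cong (y ^_) ([no-1]-zeroTail z))) (*-identityʳ y)))
           (+-cong (≈-trans (ΣO-cong n λ {w} _ → ≈-trans (*-identityʳ _) (twosOnly-1≈0 f-twos w))
                          (ΣO-twosOnly n (twosOnly-∷ f-twos 0F)))
                   (ΣO-twosOnly-[no-1] n (twosOnly-∷ f-twos 2F) y)) ⟩
    ΣZ n (λ w → f (0F ∷ w) * y) + (ΣZ n (λ w → f (0F ∷ w) * ι (suc (others w))) + _)
      ≈⟨ +-assoc _ _ _ ⟨
    (ΣZ n (λ w → f (0F ∷ w) * y) + ΣZ n (λ w → f (0F ∷ w) * ι (suc (others w)))) + _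
      ≈⟨ +-congʳ (≈-trans (≈-sym (ΣZ-+ n _ _)) (ΣZ-cong n λ _ → ≈-sym (distribˡ _ _ _))) ⟩
    ΣZ n (λ w → f (0F ∷ w) * (y + ι (suc (others w)))) + _ ∎

  -- Inverting powers of b along the core label order.

  module Inversion (b t : Carrier) (t+b≈1 : t + b ≈ 1#) where

    -- Here t is 1 - b. It is a parameter of its own because it will be q, the inverse of x (y - 1)
    -- + 1.
    weight : Word n → Carrier
    weight w = b ^ twos w * t ^ others w

    private
      weight-t : ∀ s o χ → χ * (b ^ s * t ^ suc o) ≈ t * (χ * (b ^ s * t ^ o))
      weight-t s o χ = solve 4 (λ x bs t to → x :* (bs :* (t :* to)) := t :* (x :* (bs :* to)))
        ≈-refl χ (b ^ s) t (t ^ o)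

      weight-b : ∀ s o χ → χ * (b ^ suc s * t ^ o) ≈ b * (χ * (b ^ s * t ^ o))
      weight-b s o χ = solve 4 (λ x b bs to → x :* ((b :* bs) :* to) := b :* (x :* (bs :* to)))
        ≈-refl χ b (b ^ s) (t ^ o)

      ΣZ-weight-t : ∀ n (f : Word n → Carrier) →
        ΣZ n (λ w → f w * (b ^ twos w * t ^ suc (others w))) ≈ t * ΣZ n (λ w → f w * weight w)
      ΣZ-weight-t n f =
        ≈-trans (ΣZ-cong n λ {w} _ → weight-t (twos w) (others w) (f w)) (ΣZ-*ˡ n t _)

      ΣZ-weight-b : ∀ n (f : Word n → Carrier) →
        ΣZ n (λ w → f w * (b ^ suc (twos w) * t ^ others w)) ≈ b * ΣZ n (λ w → f w * weight w)
      ΣZ-weight-b n f =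
        ≈-trans (ΣZ-cong n λ {w} _ → weight-b (twos w) (others w) (f w)) (ΣZ-*ˡ n b _)

      ΣO-weight-t : ∀ n (f : Word n → Carrier) →
        ΣO n (λ w → f w * (b ^ twos w * t ^ suc (others w))) ≈ t * ΣO n (λ w → f w * weight w)
      ΣO-weight-t n f =
        ≈-trans (ΣO-cong n λ {w} _ → weight-t (twos w) (others w) (f w)) (ΣO-*ˡ n t _)

      ΣO-weight-b : ∀ n (f : Word n → Carrier) →
        ΣO n (λ w → f w * (b ^ suc (twos w) * t ^ others w)) ≈ b * ΣO n (λ w → f w * weight w)
      ΣO-weight-b n f =
        ≈-trans (ΣO-cong n λ {w} _ → weight-b (twos w) (others w) (f w)) (ΣO-*ˡ n b _)

      t*+b*≈ : ∀ {p q s} → p ≈ t * s → q ≈ b * s → p + q ≈ s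
      t*+b*≈ {s = s} p≈ q≈ = ≈-trans (+-cong p≈ q≈)
        (≈-trans (≈-sym (distribʳ s t b)) (≈-trans (*-congʳ t+b≈1) (*-identityˡ s)))

    -- Each entry of v other than 2 is kept, with factor t, or turned into 2, with factor b, and t +
    -- b = 1. Each 2 of v stays and gives b.
    ΣZ-weight : ∀ {n} {v : Word n} → ZeroTail v → ΣZ n (λ w → χ (v ≼? w) * weight w) ≈ b ^ twos v
    ΣZ-weight []     = ≈-trans (*-identityˡ _) (*-identityˡ _)
    ΣZ-weight {suc n} (0∷_ {w = v} z) = t*+b*≈
      (≈-trans (ΣZ-weight-t n _) (*-congˡ (ΣZ-weight z)))
      (≈-trans (ΣZ-weight-b n _) (*-congˡ (ΣZ-weight z)))
    ΣZ-weight {suc n} (2∷_ {w = v} z) = ≈-trans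
      (+-cong (ΣZ-0* n _) (≈-trans (ΣZ-weight-b n _) (*-congˡ (ΣZ-weight z))))
      (+-identityˡ _)

    -- The entrywise choice is that of `ΣZ-weight`. When a leading 0 is turned into 2, the rest of
    -- the sum runs over one tails, so the zero tail v is then read as a one tail.
    ΣO-weight : ∀ {n} {v : Word n} → OneTail v → ΣO n (λ w → χ (v ≼? w) * weight w) ≈ b ^ twos v
    ΣO-weight []     = ≈-trans (*-identityˡ _) (*-identityˡ _)
    ΣO-weight {suc n} (0∷_ {w = v} z) = t*+b*≈
      (≈-trans (ΣZ-weight-t n _) (*-congˡ (ΣZ-weight z)))
      (≈-trans (+-cong (ΣO-0* n _)
                     (≈-trans (ΣO-weight-b n _) (*-congˡ (ΣO-weight (ZeroTail⇒OneTail z)))))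
             (+-identityˡ _))
    ΣO-weight {suc n} (1∷_ {w = v} o) = ≈-trans (+-congʳ (ΣZ-0* n _)) (≈-trans (+-identityˡ _)
      (t*+b*≈
      (≈-trans (ΣO-weight-t n _) (*-congˡ (ΣO-weight o)))
      (≈-trans (ΣO-weight-b n _) (*-congˡ (ΣO-weight o)))))
    ΣO-weight {suc n} (2∷_ {w = v} o) = ≈-trans (+-congʳ (ΣZ-0* n _)) (≈-trans (+-identityˡ _)
      (≈-trans
      (+-cong (ΣO-0* n _) (≈-trans (ΣO-weight-b n _) (*-congˡ (ΣO-weight o))))
      (+-identityˡ _)))

    -- For a given set of twos there are `suc (others w)` triwords that begin with 1, each with
    -- value `b * weight w`. The value at `0 ∷ w` is what they leave missing from `weight w`;
    -- `merge` is this computation.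
    kernel : Word (suc n) → Carrier
    kernel (0F ∷ w) = weight w * (1# - ι (suc (others w)) * b)
    kernel (1F ∷ w) = b * weight w
    kernel (2F ∷ w) = 0#

    private
      χ*b*weight-twosOnly : (v : Word n) → TwosOnly (λ w → χ (v ⊆₂? w) * (b * weight w))
      χ*b*weight-twosOnly v {w} {w′} w⊆w′ w′⊆w = *-cong
        (χ-cong (v ⊆₂? w) (v ⊆₂? w′) (λ v⊆w → ⊆₂-trans v⊆w w⊆w′) (λ v⊆w′ → ⊆₂-trans v⊆w′ w′⊆w))
        (*-congˡ (≈-reflexive (cong₂ (λ s o → b ^ s * t ^ o)
          (twos-cong w⊆w′ w′⊆w) (others-cong w⊆w′ w′⊆w))))

    cancel : ∀ i → (1# - i * b) + i * b ≈ 1#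
    cancel i = ≈-trans (+-assoc _ _ _) (≈-trans (+-congˡ (-‿inverseˡ _)) (+-identityʳ _))

    private
      merge : ∀ c W i → c * (W * (1# - i * b)) + (c * (b * W)) * i ≈ c * W
      merge c W i = begin
        c * (W * (1# - i * b)) + (c * (b * W)) * i
          ≈⟨ solve 5 (λ c W m b i →
               c :* (W :* m) :+ (c :* (b :* W)) :* i := (c :* W) :* (m :+ i :* b))
               ≈-refl c W (1# - i * b) b i ⟩
        (c * W) * ((1# - i * b) + i * b) ≈⟨ *-congˡ (cancel i) ⟩
        (c * W) * 1#                     ≈⟨ *-identityʳ _ ⟩
        c * W                            ∎

    -- Above `0 ∷ v` membership depends on the twos only, so the terms with equal twos combine to a
    -- single `weight`, and `ΣZ-weight` applies. Above `1 ∷ v` all words begin with 1, and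
    -- `ΣO-weight` applies directly.
    ∑-kernel : (v : Word (suc n)) → IsTriword v →
               Σ[Tri] (suc n) (λ w → χ (v ⊴? value w) * kernel (value w)) ≈ b ^ height v
    ∑-kernel {n} (0F ∷ v) t = ≈-trans (Σ[Tri]-split n (λ w → χ ((0F ∷ v) ⊴? w) * kernel w)) (begin
      ΣZ n (λ w → χ (v ⊆₂? w) * kernel (0F ∷ w)) + ΣO n (λ w → χ (v ⊆₂? w) * (b * weight w))
        ≈⟨ +-congˡ (ΣO-twosOnly n (χ*b*weight-twosOnly v)) ⟩
      ΣZ n (λ w → χ (v ⊆₂? w) * kernel (0F ∷ w)) + _
        ≈⟨ ΣZ-+ n _ _ ⟨
      ΣZ n _
        ≈⟨ ΣZ-cong n (λ {w} z → ≈-trans (merge (χ (v ⊆₂? w)) (weight w) (ι (suc (others w))))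
             (*-congʳ (χ-cong (v ⊆₂? w) (v ≼? w) (⊆₂⇒≼ (0∷-isTriword⁻ t) z) ≼⇒⊆₂))) ⟩
      ΣZ n (λ w → χ (v ≼? w) * weight w)
        ≈⟨ ΣZ-weight (0∷-isTriword⁻ t) ⟩
      b ^ twos v ∎)
    ∑-kernel {n} (1F ∷ v) t = ≈-trans (Σ[Tri]-split n (λ w → χ ((1F ∷ v) ⊴? w) * kernel w)) (begin
      ΣZ n (λ w → 0# * kernel (0F ∷ w)) + ΣO n (λ w → χ (v ≼? w) * (b * weight w))
        ≈⟨ ≈-trans (+-congʳ (ΣZ-0* n _)) (+-identityˡ _) ⟩
      ΣO n (λ w → χ (v ≼? w) * (b * weight w))
        ≈⟨ ΣO-cong n (λ {w} _ →
             solve 3 (λ c b W → c :* (b :* W) := b :* (c :* W)) ≈-refl _ b (weight w)) ⟩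
      ΣO n (λ w → b * (χ (v ≼? w) * weight w))
        ≈⟨ ≈-trans (ΣO-*ˡ n b _) (*-congˡ (ΣO-weight (1∷-isTriword⁻ t))) ⟩
      b * b ^ twos v ∎)
    ∑-kernel (2F ∷ v) t = contradiction t 2∷-¬isTriword

  -- Evaluation at the arguments of the `H`-triangle.

  module Evaluation (x y p q : Carrier)
    (dp≈1 : (y - 1#) * p ≈ 1#) (Xq≈1 : (x * (y - 1#) + 1#) * q ≈ 1#) where

    private
      d = y - 1#
      X = x * d + 1#
      a = y * p
      b = x * d * q

      q+b≈1 : q + b ≈ 1#
      q+b≈1 = ≈-trans
        (solve 3 (λ x d q → q :+ x :* d :* q := (x :* d :+ con 1) :* q) ≈-refl x d q) Xq≈1

    open Inversion b q q+b≈1 public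

    private
      Xab≈xy : X * (a * b) ≈ x * y
      Xab≈xy = begin
        X * (a * b)               ≈⟨ solve 6 (λ X y p x d q → X :* ((y :* p) :* (x :* d :* q)) :=
                                       (X :* q) :* ((d :* p) :* (x :* y))) ≈-refl X y p x d q ⟩
        (X * q) * ((d * p) * (x * y)) ≈⟨ *-cong Xq≈1 (*-congʳ dp≈1) ⟩
        1# * (1# * (x * y))       ≈⟨ ≈-trans (*-identityˡ _) (*-identityˡ _) ⟩
        x * y                     ∎

      Xb≈xd : X * b ≈ x * d
      Xb≈xd = begin
        X * b              ≈⟨ solve 4 (λ X x d q → X :* (x :* d :* q) := (X :* q) :* (x :* d))
                                ≈-refl X x d q ⟩
        (X * q) * (x * d)  ≈⟨ ≈-trans (*-congʳ Xq≈1) (*-identityˡ _) ⟩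
        x * d              ∎

      X^z*q^z : ∀ z → X ^ z * q ^ z ≈ 1#
      X^z*q^z zero    = *-identityˡ 1#
      X^z*q^z (suc z) = begin
        (X * X ^ z) * (q * q ^ z) ≈⟨ *-interchange X (X ^ z) q (q ^ z) ⟩
        (X * q) * (X ^ z * q ^ z) ≈⟨ *-cong Xq≈1 (X^z*q^z z) ⟩
        1# * 1#                   ≈⟨ *-identityˡ 1# ⟩
        1#                        ∎

      -- Each tail entry receives one factor X: at a 2 it meets a and b and gives x y, elsewhere it
      -- meets q and gives 1.
      X^*a^*weight : ∀ s z → X ^ (s ℕ.+ z) * (a ^ s * (b ^ s * q ^ z)) ≈ (x * y) ^ s
      X^*a^*weight zero    z = ≈-trans (*-congˡ (≈-trans (*-identityˡ _) (*-identityˡ _))) (X^z*q^z z)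
      X^*a^*weight (suc s) z = begin
        (X * X ^ (s ℕ.+ z)) * ((a * a ^ s) * ((b * b ^ s) * q ^ z))
          ≈⟨ solve 7 (λ X Xs a as b bs qz → (X :* Xs) :* ((a :* as) :* ((b :* bs) :* qz)) :=
               (X :* (a :* b)) :* (Xs :* (as :* (bs :* qz)))) ≈-refl
               X (X ^ (s ℕ.+ z)) a (a ^ s) b (b ^ s) (q ^ z) ⟩
        (X * (a * b)) * (X ^ (s ℕ.+ z) * (a ^ s * (b ^ s * q ^ z)))
          ≈⟨ *-cong Xab≈xy (X^*a^*weight s z) ⟩
        (x * y) * (x * y) ^ s ∎

      scale : (w : Word n) → X ^ n * (a ^ twos w * weight w) ≈ (x * y) ^ twos w
      scale w = ≈-trans (*-congʳ (≈-reflexive (cong (X ^_) (sym (twos+others w)))))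
                        (X^*a^*weight (twos w) (others w))

      -- The power has one X more than `scale` consumes, that of the first entry. Here it stays with
      -- the correction factor of the kernel; in `one-term` it meets a and b.
      zero-term : (w : Word n) →
        X ^ suc n * (a ^ twos w * kernel (0F ∷ w)) ≈
        (x * y) ^ twos w * (X * (1# - ι (suc (others w)) * b))
      zero-term {n} w = begin
        (X * X ^ n) * (a ^ twos w * (weight w * m))
          ≈⟨ solve 5 (λ X Xn as W m →
               (X :* Xn) :* (as :* (W :* m)) := (Xn :* (as :* W)) :* (X :* m))
               ≈-refl X (X ^ n) (a ^ twos w) (weight w) m ⟩
        (X ^ n * (a ^ twos w * weight w)) * (X * m) ≈⟨ *-congʳ (scale w) ⟩
        (x * y) ^ twos w * (X * m) ∎
        where m = 1# - ι (suc (others w)) * b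

      one-term : (w : Word n) →
        X ^ suc n * (a ^ suc (twos w) * kernel (1F ∷ w)) ≈ (x * y) ^ twos w * (x * y)
      one-term {n} w = begin
        (X * X ^ n) * ((a * a ^ twos w) * (b * weight w))
          ≈⟨ solve 6 (λ X Xn a as b W → (X :* Xn) :* ((a :* as) :* (b :* W)) :=
               (Xn :* (as :* W)) :* (X :* (a :* b))) ≈-refl X (X ^ n) a (a ^ twos w) b (weight w) ⟩
        (X ^ n * (a ^ twos w * weight w)) * (X * (a * b)) ≈⟨ *-cong (scale w) Xab≈xy ⟩
        (x * y) ^ twos w * (x * y) ∎

      xy^twos-twosOnly : ∀ c → TwosOnly {n} (λ w → (x * y) ^ twos w * c)
      xy^twos-twosOnly c v⊆w w⊆v =
        *-congʳ (≈-reflexive (cong ((x * y) ^_) (twos-cong v⊆w w⊆v)))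

      y≈d+1 : y ≈ d + 1#
      y≈d+1 = ≈-sym (≈-trans (+-assoc y _ _) (≈-trans (+-congˡ (-‿inverseˡ 1#)) (+-identityʳ y)))

      -- The whole identity for one set of twos, without the common factor (x y) ^ |S|, where i
      -- counts the tail entries other than 2. On the right, 1 stands for `0 ∷ w` and x (y + i) for
      -- the triwords that begin with 1. Writing y as d + 1 lets X b = x d cancel the terms with b.
      balance : ∀ i → X * (1# - (1# + i) * b) + (x * y) * (1# + i) ≈ 1# + x * (y + i)
      balance i = begin
        X * m + (x * y) * (1# + i)
          ≈⟨ +-congˡ (*-congʳ (*-congˡ y≈d+1)) ⟩
        X * m + (x * (d + 1#)) * (1# + i)
          ≈⟨ solve 4 (λ Xm x d i → Xm :+ (x :* (d :+ con 1)) :* (con 1 :+ i) :=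
               (Xm :+ (con 1 :+ i) :* (x :* d)) :+ x :* (con 1 :+ i)) ≈-refl (X * m) x d i ⟩
        (X * m + (1# + i) * (x * d)) + x * (1# + i)
          ≈⟨ +-congʳ (+-congˡ (*-congˡ (≈-sym Xb≈xd))) ⟩
        (X * m + (1# + i) * (X * b)) + x * (1# + i)
          ≈⟨ +-congʳ (solve 4 (λ X m i b → X :* m :+ (con 1 :+ i) :* (X :* b) :=
               X :* (m :+ (con 1 :+ i) :* b)) ≈-refl X m i b) ⟩
        X * (m + (1# + i) * b) + x * (1# + i)
          ≈⟨ +-congʳ (≈-trans (*-congˡ (cancel (1# + i))) (*-identityʳ X)) ⟩
        (x * d + 1#) + x * (1# + i)
          ≈⟨ solve 3 (λ x d i → (x :* d :+ con 1) :+ x :* (con 1 :+ i) :=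
               con 1 :+ x :* ((d :+ con 1) :+ i)) ≈-refl x d i ⟩
        1# + x * ((d + 1#) + i)
          ≈⟨ +-congˡ (*-congˡ (+-congʳ (≈-sym y≈d+1))) ⟩
        1# + x * (y + i) ∎
        where m = 1# - (1# + i) * b

    -- A zero tail encodes a set of twos. The words that begin with 1 are collected over these sets,
    -- `regroup` compares the terms set by set, and `ΣO-twosOnly-[no-1]` spreads the result out
    -- again.
    X^*∑-kernel : ∀ n →
      X ^ suc n * Σ[Tri] (suc n) (λ u → a ^ height (value u) * kernel (value u)) ≈
      Σ[Tri] (suc n) (λ u → x ^ height (value u) * y ^ atomicity (value u))
    X^*∑-kernel n = begin
      X ^ suc n * Σ[Tri] (suc n) (λ u → a ^ height (value u) * kernel (value u))
        ≈⟨ ∑-*ˡ (triwords (suc n)) _ _ ⟨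
      Σ[Tri] (suc n) (λ u → X ^ suc n * (a ^ height (value u) * kernel (value u)))
        ≈⟨ Σ[Tri]-split n (λ u → X ^ suc n * (a ^ height u * kernel u)) ⟩
      ΣZ n (λ w → X ^ suc n * (a ^ twos w * kernel (0F ∷ w))) +
      ΣO n (λ w → X ^ suc n * (a ^ suc (twos w) * kernel (1F ∷ w)))
        ≈⟨ +-cong (ΣZ-cong n λ {w} _ → zero-term w)
             (≈-trans (ΣO-cong n λ {w} _ → one-term w) (ΣO-twosOnly n (xy^twos-twosOnly (x * y)))) ⟩
      ΣZ n (λ w → (x * y) ^ twos w * (X * (1# - ι (suc (others w)) * b))) +
      ΣZ n (λ w → ((x * y) ^ twos w * (x * y)) * ι (suc (others w)))
        ≈⟨ ΣZ-+ n _ _ ⟨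
      ΣZ n _
        ≈⟨ ΣZ-cong n (λ {w} _ → regroup w) ⟩
      ΣZ n (λ w → x ^ twos w * y ^ twos w + ((x * y) ^ twos w * x) * (y + ι (others w)))
        ≈⟨ ΣZ-+ n _ _ ⟩
      ΣZ n (λ w → x ^ twos w * y ^ twos w) +
      ΣZ n (λ w → ((x * y) ^ twos w * x) * (y + ι (others w)))
        ≈⟨ +-congˡ (≈-trans (≈-sym (ΣO-twosOnly-[no-1] n (xy^twos-twosOnly x) y))
             (ΣO-cong n λ {w} _ → split-power w)) ⟩
      ΣZ n (λ w → x ^ twos w * y ^ twos w) +
      ΣO n (λ w → x ^ suc (twos w) * y ^ ([no-1] w ℕ.+ twos w))
        ≈⟨ Σ[Tri]-split n (λ u → x ^ height u * y ^ atomicity u) ⟨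
      Σ[Tri] (suc n) (λ u → x ^ height (value u) * y ^ atomicity (value u)) ∎
      where
      regroup : (w : Word n) →
        (x * y) ^ twos w * (X * (1# - ι (suc (others w)) * b)) +
        ((x * y) ^ twos w * (x * y)) * ι (suc (others w)) ≈
        x ^ twos w * y ^ twos w + ((x * y) ^ twos w * x) * (y + ι (others w))
      regroup w = begin
        P * (X * m) + (P * (x * y)) * i
          ≈⟨ solve 4 (λ P Xm xy i → P :* Xm :+ (P :* xy) :* i := P :* (Xm :+ xy :* i))
               ≈-refl P (X * m) (x * y) i ⟩
        P * (X * m + (x * y) * i)
          ≈⟨ *-congˡ (balance (ι (others w))) ⟩
        P * (1# + x * (y + ι (others w)))
          ≈⟨ solve 3 (λ P x j → P :* (con 1 :+ x :* j) := P :+ (P :* x) :* j)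
               ≈-refl P x (y + ι (others w)) ⟩
        P + (P * x) * (y + ι (others w))
          ≈⟨ +-congʳ (^-distrib-* x y (twos w)) ⟩
        x ^ twos w * y ^ twos w + (P * x) * (y + ι (others w)) ∎
        where
        P = (x * y) ^ twos w
        i = ι (suc (others w))
        m = 1# - i * b

      split-power : (w : Word n) → ((x * y) ^ twos w * x) * y ^ [no-1] w ≈
                                   x ^ suc (twos w) * y ^ ([no-1] w ℕ.+ twos w)
      split-power w = begin
        ((x * y) ^ twos w * x) * y ^ [no-1] w
          ≈⟨ *-congʳ (*-congʳ (^-distrib-* x y (twos w))) ⟩
        ((x ^ twos w * y ^ twos w) * x) * y ^ [no-1] w
          ≈⟨ solve 4 (λ xs ys x ye → ((xs :* ys) :* x) :* ye := (x :* xs) :* (ye :* ys))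
               ≈-refl _ _ _ _ ⟩
        x ^ suc (twos w) * (y ^ [no-1] w * y ^ twos w)
          ≈⟨ *-congˡ (^-homo-* y ([no-1] w) (twos w)) ⟨
        x ^ suc (twos w) * y ^ ([no-1] w ℕ.+ twos w) ∎

proposition6p17 : (n : ℕ) → n > 0 →
    let module L = FiniteLattice (Hoch n) in
    (rk : Tri n → ℕ) → IsRankFunction L._⊑_ 𝟎 rk →
    (μ : Tri n → Tri n → ℤ) → L.IsMöbiusFunction L._⊑?_ μ →
    ∀ {c ℓ} (R : CommutativeRing c ℓ) →
    let open CommutativeRing R in
    let open Triangles R in
    (x y p q : Carrier) →
    (y - 1#) * p ≈ 1# →
    (x * (y - 1#) + 1#) * q ≈ 1# →
    H-triangle n rk μ x y p q ≈ Σ[Tri] n (λ u → x ^ L.∣Can∣ u * y ^ L.neg u)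
proposition6p17 (suc n) _ rk isRank μ isMöbius R x y p q dp≈1 Xq≈1 = begin
  X ^ suc n * Σ[Tri] (suc n) (λ u → Σ[Tri] (suc n) λ v → μ u v · (a ^ rk u * b ^ rk v))
    -- For fixed u the sum over v is the Möbius inversion of `b ^ rk`, with `a ^ rk u` as constant
    -- factor; this is where `μ` disappears.
    ≈⟨ *-congˡ (∑-cong (triwords (suc n)) λ u → inversion b^rk≈∑-kernel u (a ^ rk u)) ⟩
  X ^ suc n * Σ[Tri] (suc n) (λ u → a ^ rk u * kernel (value u))
    ≈⟨ *-congˡ (∑-cong (triwords (suc n)) λ u →
         *-congʳ (≈-reflexive (cong (a ^_) (rank≡height n rk isRank u)))) ⟩
  X ^ suc n * Σ[Tri] (suc n) (λ u → a ^ height (value u) * kernel (value u))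
    ≈⟨ X^*∑-kernel n ⟩
  Σ[Tri] (suc n) (λ u → x ^ height (value u) * y ^ atomicity (value u))
    ≈⟨ ∑-cong (triwords (suc n)) (λ u → ≈-reflexive (cong₂ (λ i j → x ^ i * y ^ j)
         (sym (∣Can∣≡height n u)) (sym (neg≡atomicity n u)))) ⟩
  Σ[Tri] (suc n) (λ u → x ^ L.∣Can∣ u * y ^ L.neg u) ∎
  where
  module L = FiniteLattice (Hoch (suc n))
  open CommutativeRing R using (_≈_; _+_; _*_; _-_; 1#; setoid; *-congˡ; *-congʳ)
    renaming (reflexive to ≈-reflexive)
  open Triangles R
  open Sums R
  open WordSums R
  open Evaluation x y p q dp≈1 Xq≈1
  open import Relation.Binary.Reasoning.Setoid setoid
  open MöbiusInversion (Hoch (suc n)) L._⊑?_ (⊑-refl n) (⊑-trans n) (⊑-antisym n) μ isMöbius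

  X = x * (y - 1#) + 1#
  a = y * p
  b = x * (y - 1#) * q

  b^rk≈∑-kernel : ∀ u → b ^ rk u ≈ Σ[Tri] (suc n) (λ v → χ (u L.⊑? v) * kernel (value v))
  b^rk≈∑-kernel u = begin
    b ^ rk u
      ≡⟨ cong (b ^_) (rank≡height n rk isRank u) ⟩
    b ^ height (value u)
      ≈⟨ ∑-kernel (value u) (isTriword u) ⟨
    Σ[Tri] (suc n) (λ v → χ (value u ⊴? value v) * kernel (value v))
      ≈⟨ ∑-cong (triwords (suc n)) (λ v → *-congʳ (χ-cong (value u ⊴? value v) (u L.⊑? v)
           (λ u⊴v {c} → ⊴⇒⊑ n u v u⊴v {c}) λ u⊑v → ⊑⇒⊴ n u v λ {c} → u⊑v {c})) ⟩
    Σ[Tri] (suc n) (λ v → χ (u L.⊑? v) * kernel (value v)) ∎
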